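{- Let $n\ge 2$ and $k\ge 2$. The Seidel energy of the hyperstar $S_n^k$ is $$SE(S_n^k)=(n-1)(3k-5)-(2k-3)+\sqrt{(k-1)^2(n-3)^2+2(k-1)(3n-5)+1}.$$
   Context: A hypergraph $G^*=(V,E)$ has a finite vertex set $V=\{v_1,\dots,v_N\}$ and a finite set $E$ of hyperedges, each a subset of $V$. Its adjacency matrix $A=(a_{ij})$ has $a_{ij}=|\{e\in E:\{v_i,v_j\}\subset e\}|$ for $i\ne j$ and $a_{ii}=0$. Its Seidel matrix is $S=J_N-I_N-2A$ ($J_N$ all-ones matrix, $I_N$ identity). The Seidel energy $SE(G^*)$ is the sum of the absolute values of the eigenvalues of $S$, counted with multiplicity. The hyperstar $S_n^k$ has the $(n-1)(k-1)+1$ vertices $v_{0,0}$ and $v_{i,j}$ ($1\le i\le n-1$, $1\le j\le k-1$), and the $n-1$ hyperedges $\{v_{0,0},v_{i,1},\dots,v_{i,k-1}\}$, $1\le i\le n-1$. -}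

module Defs where

open import Level using (0ℓ)
open import Algebra.Bundles.Raw using (RawRing)
import Algebra.Definitions.RawMonoid as RawMonoidDefs
import Algebra.Definitions.RawSemiring as RawSemiringDefs
open import Data.Bool.Base using (true; if_then_else_)
open import Data.Nat.Base as ℕ using (ℕ; suc)
import Data.Nat.Properties as ℕ
open import Data.Integer.Base using (ℤ; +_)
open import Data.Rational.Base as ℚ using (ℚ; 0ℚ; 1ℚ; ½)
import Data.Rational.Properties as ℚ
open import Data.Rational.Solver using (module +-*-Solver)
open import Data.Fin.Base using (Fin; zero; suc; toℕ; punchIn; quotient; combine)
open import Data.Fin.Properties using (_≟_; remQuot-combine)
open import Data.Fin.Subset using (Subset; inside; _∪_; ⁅_⁆)
open import Data.Fin.Subset.Properties using (_⊆?_)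
open import Data.List.Base using (List; length; filter; tabulate)
open import Data.List.Relation.Unary.Unique.Propositional using (Unique)
open import Data.List.Relation.Unary.Unique.Propositional.Properties using (tabulate⁺)
open import Data.Product.Base using (Σ-syntax; ∃-syntax; _×_; _,_; proj₁; proj₂)
open import Data.Sum.Base using (inj₁; inj₂)
import Data.Vec.Base as Vec
open import Data.Vec.Functional using (Vector)
open import Data.Vec.Properties using (lookup∘tabulate)
open import Relation.Nullary.Decidable using (Dec; does; yes; dec-true)
open import Relation.Binary.PropositionalEquality
  using (_≡_; refl; sym; trans; cong; subst; subst₂)

-- Real numbers: Cauchy sequences of rationals (Cantor's construction),
-- taken up to the equivalence _≃ᴿ_ (the difference tends to 0).

IsCauchy : (ℕ → ℚ) → Set
IsCauchy x = ∀ ε → 0ℚ ℚ.< ε →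
  ∃[ N ] ∀ m n → N ℕ.≤ m → N ℕ.≤ n → ℚ.∣ x m ℚ.- x n ∣ ℚ.< ε

record ℝ : Set where
  constructor mkℝ
  field
    seq    : ℕ → ℚ
    cauchy : IsCauchy seq

open ℝ public

infix 4 _≃ᴿ_ _≤ᴿ_

_≃ᴿ_ : ℝ → ℝ → Set
x ≃ᴿ y = ∀ ε → 0ℚ ℚ.< ε →
  ∃[ N ] ∀ n → N ℕ.≤ n → ℚ.∣ seq x n ℚ.- seq y n ∣ ℚ.< ε

_≤ᴿ_ : ℝ → ℝ → Set
x ≤ᴿ y = ∀ ε → 0ℚ ℚ.< ε →
  ∃[ N ] ∀ n → N ℕ.≤ n → seq x n ℚ.≤ seq y n ℚ.+ ε

module CauchyLemmas where
  half-pos : ∀ {ε} → 0ℚ ℚ.< ε → 0ℚ ℚ.< ½ ℚ.* ε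
  half-pos {ε} 0<ε = ℚ.positive⁻¹ (½ ℚ.* ε)
    where instance
      _ = ℚ.positive 0<ε
      _ = ℚ.pos*pos⇒pos ½ ε

  halves : ∀ ε → ½ ℚ.* ε ℚ.+ ½ ℚ.* ε ≡ ε
  halves ε = trans (sym (ℚ.*-distribʳ-+ ε ½ ½)) (ℚ.*-identityˡ ε)

  +-dist : ∀ a b c d → ℚ.∣ (a ℚ.+ b) ℚ.- (c ℚ.+ d) ∣ ℚ.≤ ℚ.∣ a ℚ.- c ∣ ℚ.+ ℚ.∣ b ℚ.- d ∣
  +-dist a b c d = subst (λ t → ℚ.∣ t ∣ ℚ.≤ ℚ.∣ a ℚ.- c ∣ ℚ.+ ℚ.∣ b ℚ.- d ∣)
    (solve 4 (λ a b c d → (a :- c) :+ (b :- d) := (a :+ b) :- (c :+ d)) refl a b c d)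
    (ℚ.∣p+q∣≤∣p∣+∣q∣ (a ℚ.- c) (b ℚ.- d))
    where open +-*-Solver

  neg-dist : ∀ a b → ℚ.∣ ℚ.- a ℚ.- ℚ.- b ∣ ≡ ℚ.∣ a ℚ.- b ∣
  neg-dist a b = trans
    (cong ℚ.∣_∣ (solve 2 (λ a b → :- a :- :- b := :- (a :- b)) refl a b))
    (ℚ.∣-p∣≡∣p∣ (a ℚ.- b))
    where open +-*-Solver

  *-dist : ∀ a b c d →
    ℚ.∣ a ℚ.* b ℚ.- c ℚ.* d ∣ ℚ.≤ ℚ.∣ a ∣ ℚ.* ℚ.∣ b ℚ.- d ∣ ℚ.+ ℚ.∣ d ∣ ℚ.* ℚ.∣ a ℚ.- c ∣
  *-dist a b c d = begin
    ℚ.∣ a ℚ.* b ℚ.- c ℚ.* d ∣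
      ≡⟨ cong ℚ.∣_∣ (solve 4 (λ a b c d →
           a :* b :- c :* d := a :* (b :- d) :+ d :* (a :- c)) refl a b c d) ⟩
    ℚ.∣ a ℚ.* (b ℚ.- d) ℚ.+ d ℚ.* (a ℚ.- c) ∣
      ≤⟨ ℚ.∣p+q∣≤∣p∣+∣q∣ (a ℚ.* (b ℚ.- d)) (d ℚ.* (a ℚ.- c)) ⟩
    ℚ.∣ a ℚ.* (b ℚ.- d) ∣ ℚ.+ ℚ.∣ d ℚ.* (a ℚ.- c) ∣
      ≡⟨ cong (ℚ._+ ℚ.∣ d ℚ.* (a ℚ.- c) ∣) (ℚ.∣p*q∣≡∣p∣*∣q∣ a (b ℚ.- d)) ⟩
    ℚ.∣ a ∣ ℚ.* ℚ.∣ b ℚ.- d ∣ ℚ.+ ℚ.∣ d ℚ.* (a ℚ.- c) ∣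
      ≡⟨ cong (ℚ.∣ a ∣ ℚ.* ℚ.∣ b ℚ.- d ∣ ℚ.+_) (ℚ.∣p*q∣≡∣p∣*∣q∣ d (a ℚ.- c)) ⟩
    ℚ.∣ a ∣ ℚ.* ℚ.∣ b ℚ.- d ∣ ℚ.+ ℚ.∣ d ∣ ℚ.* ℚ.∣ a ℚ.- c ∣ ∎
    where
    open +-*-Solver
    open ℚ.≤-Reasoning

  ≤-dist : ∀ a b → ℚ.∣ a ∣ ℚ.≤ ℚ.∣ b ∣ ℚ.+ ℚ.∣ a ℚ.- b ∣
  ≤-dist a b = subst (λ t → ℚ.∣ t ∣ ℚ.≤ ℚ.∣ b ∣ ℚ.+ ℚ.∣ a ℚ.- b ∣)
    (solve 2 (λ a b → b :+ (a :- b) := a) refl a b)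
    (ℚ.∣p+q∣≤∣p∣+∣q∣ b (a ℚ.- b))
    where open +-*-Solver

  dist-sym : ∀ a b → ℚ.∣ a ℚ.- b ∣ ≡ ℚ.∣ b ℚ.- a ∣
  dist-sym a b = trans
    (cong ℚ.∣_∣ (solve 2 (λ a b → a :- b := :- (b :- a)) refl a b))
    (ℚ.∣-p∣≡∣p∣ (b ℚ.- a))
    where open +-*-Solver

  sub-≤ : ∀ {p q r} → p ℚ.≤ q ℚ.+ r → p ℚ.- q ℚ.≤ r
  sub-≤ {p} {q} {r} p≤q+r = subst (p ℚ.- q ℚ.≤_)
    (solve 2 (λ q r → (q :+ r) :- q := r) refl q r)
    (ℚ.+-monoˡ-≤ (ℚ.- q) p≤q+r)
    where open +-*-Solver

  ∣∣-dist : ∀ a b → ℚ.∣ ℚ.∣ a ∣ ℚ.- ℚ.∣ b ∣ ∣ ℚ.≤ ℚ.∣ a ℚ.- b ∣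
  ∣∣-dist a b with ℚ.∣p∣≡p∨∣p∣≡-p (ℚ.∣ a ∣ ℚ.- ℚ.∣ b ∣)
  ... | inj₁ eq = subst (ℚ._≤ ℚ.∣ a ℚ.- b ∣) (sym eq) (sub-≤ (≤-dist a b))
  ... | inj₂ eq = subst₂ ℚ._≤_
    (trans (solve 2 (λ p q → q :- p := :- (p :- q)) refl ℚ.∣ a ∣ ℚ.∣ b ∣) (sym eq))
    (dist-sym b a) (sub-≤ (≤-dist b a))
    where open +-*-Solver

  bounded : ∀ {x} → IsCauchy x →
    Σ[ B ∈ ℚ ] ℚ.Positive B × (∃[ N ] ∀ n → N ℕ.≤ n → ℚ.∣ x n ∣ ℚ.≤ B)
  bounded {x} cx with cx 1ℚ (ℚ.positive⁻¹ 1ℚ)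
  ... | N , h =
      ℚ.∣ x N ∣ ℚ.+ 1ℚ
    , ℚ.nonNeg+pos⇒pos ℚ.∣ x N ∣ {{ℚ.∣-∣-nonNeg (x N)}} 1ℚ
    , N , λ n N≤n → ℚ.≤-trans (≤-dist (x n) (x N))
            (ℚ.+-monoʳ-≤ ℚ.∣ x N ∣ (ℚ.<⇒≤ (h n N N≤n ℕ.≤-refl)))

open CauchyLemmas

infixl 6 _+ᴿ_ _-ᴿ_
infixl 7 _*ᴿ_
infix  8 -ᴿ_

fromℚ : ℚ → ℝ
fromℚ q = mkℝ (λ _ → q) λ ε 0<ε →
  0 , λ _ _ _ _ → subst (ℚ._< ε) (sym (cong ℚ.∣_∣ (ℚ.+-inverseʳ q))) 0<ε

fromℤ : ℤ → ℝ
fromℤ z = fromℚ (z ℚ./ 1)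

_+ᴿ_ : ℝ → ℝ → ℝ
x +ᴿ y = mkℝ (λ n → seq x n ℚ.+ seq y n) λ ε 0<ε →
  let Nx , hx = cauchy x (½ ℚ.* ε) (half-pos 0<ε)
      Ny , hy = cauchy y (½ ℚ.* ε) (half-pos 0<ε)
  in Nx ℕ.⊔ Ny , λ m n N≤m N≤n → ℚ.≤-<-trans
       (+-dist (seq x m) (seq y m) (seq x n) (seq y n))
       (subst (_ ℚ.<_) (halves ε) (ℚ.+-mono-<
         (hx m n (ℕ.≤-trans (ℕ.m≤m⊔n Nx Ny) N≤m) (ℕ.≤-trans (ℕ.m≤m⊔n Nx Ny) N≤n))
         (hy m n (ℕ.≤-trans (ℕ.m≤n⊔m Nx Ny) N≤m) (ℕ.≤-trans (ℕ.m≤n⊔m Nx Ny) N≤n))))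

-ᴿ_ : ℝ → ℝ
-ᴿ x = mkℝ (λ n → ℚ.- seq x n) λ ε 0<ε →
  let N , h = cauchy x ε 0<ε
  in N , λ m n N≤m N≤n →
       subst (ℚ._< ε) (sym (neg-dist (seq x m) (seq x n))) (h m n N≤m N≤n)

_-ᴿ_ : ℝ → ℝ → ℝ
x -ᴿ y = x +ᴿ (-ᴿ y)

∣_∣ᴿ : ℝ → ℝ
∣ x ∣ᴿ = mkℝ (λ n → ℚ.∣ seq x n ∣) λ ε 0<ε →
  let N , h = cauchy x ε 0<ε
  in N , λ m n N≤m N≤n → ℚ.≤-<-trans (∣∣-dist (seq x m) (seq x n)) (h m n N≤m N≤n)

module ProductLemmas where
  split : ∀ B C {ε} → ℚ.Positive B → ℚ.Positive C → 0ℚ ℚ.< ε →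
    Σ[ δ ∈ ℚ ] (0ℚ ℚ.< δ) × (B ℚ.* δ ℚ.+ C ℚ.* δ ≡ ε)
  split B C {ε} B>0 C>0 0<ε = invert (B ℚ.+ C) refl (ℚ.pos+pos⇒pos B {{B>0}} C {{C>0}})
    where
    invert : ∀ D → B ℚ.+ C ≡ D → ℚ.Positive D →
      Σ[ δ ∈ ℚ ] (0ℚ ℚ.< δ) × (B ℚ.* δ ℚ.+ C ℚ.* δ ≡ ε)
    invert D B+C≡D D>0 =
        ℚ.1/ D ℚ.* ε
      , ℚ.positive⁻¹ (ℚ.1/ D ℚ.* ε)
          {{ℚ.pos*pos⇒pos (ℚ.1/ D) {{ℚ.1/pos⇒pos D}} ε {{ℚ.positive 0<ε}}}}
      , trans (sym (ℚ.*-distribʳ-+ (ℚ.1/ D ℚ.* ε) B C))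
       (trans (cong (ℚ._* (ℚ.1/ D ℚ.* ε)) B+C≡D)
       (trans (sym (ℚ.*-assoc D (ℚ.1/ D) ε))
       (trans (cong (ℚ._* ε) (ℚ.*-inverseʳ D)) (ℚ.*-identityˡ ε))))
      where instance
        _ = D>0
        D≢0 : ℚ.NonZero D
        D≢0 = ℚ.pos⇒nonZero D

  *-bound : ∀ a d {D δ} → ℚ.Positive D → ℚ.∣ a ∣ ℚ.≤ D → ℚ.∣ d ∣ ℚ.< δ →
    ℚ.∣ a ∣ ℚ.* ℚ.∣ d ∣ ℚ.< D ℚ.* δ
  *-bound a d {D} D>0 a≤D d<δ = ℚ.≤-<-trans
    (ℚ.*-monoʳ-≤-nonNeg ℚ.∣ d ∣ {{ℚ.∣-∣-nonNeg d}} a≤D)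
    (ℚ.*-monoʳ-<-pos D {{D>0}} d<δ)

  *-close : ∀ a b c d {B C δ ε} → ℚ.Positive B → ℚ.Positive C →
    B ℚ.* δ ℚ.+ C ℚ.* δ ≡ ε → ℚ.∣ a ∣ ℚ.≤ B → ℚ.∣ d ∣ ℚ.≤ C →
    ℚ.∣ b ℚ.- d ∣ ℚ.< δ → ℚ.∣ a ℚ.- c ∣ ℚ.< δ →
    ℚ.∣ a ℚ.* b ℚ.- c ℚ.* d ∣ ℚ.< ε
  *-close a b c d {B} {C} {δ} B>0 C>0 sum≡ε a≤B d≤C b-d<δ a-c<δ = ℚ.≤-<-trans
    (*-dist a b c d)
    (ℚ.<-≤-trans
      (ℚ.+-mono-< (*-bound a (b ℚ.- d) B>0 a≤B b-d<δ) (*-bound d (a ℚ.- c) C>0 d≤C a-c<δ))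
      (ℚ.≤-reflexive sum≡ε))

  *-cauchy : ∀ x y → IsCauchy x → IsCauchy y → IsCauchy (λ n → x n ℚ.* y n)
  *-cauchy x y cx cy ε 0<ε =
    let B , B>0 , K , hB   = bounded cx
        C , C>0 , L , hC   = bounded cy
        δ , 0<δ , sum≡ε    = split B C B>0 C>0 0<ε
        M , hx             = cx δ 0<δ
        P , hy             = cy δ 0<δ
        open Thresholds K L M P
    in (K ℕ.⊔ L) ℕ.⊔ (M ℕ.⊔ P) , λ m n N≤m N≤n →
         *-close (x m) (y m) (x n) (y n) B>0 C>0 sum≡ε
           (hB m (≤K N≤m)) (hC n (≤L N≤n))
           (hy m n (≤P N≤m) (≤P N≤n)) (hx m n (≤M N≤m) (≤M N≤n))
    where
    module Thresholds K L M P {o} (N≤o : (K ℕ.⊔ L) ℕ.⊔ (M ℕ.⊔ P) ℕ.≤ o) where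
      ≤KL = ℕ.m⊔n≤o⇒m≤o (K ℕ.⊔ L) (M ℕ.⊔ P) N≤o
      ≤MP = ℕ.m⊔n≤o⇒n≤o (K ℕ.⊔ L) (M ℕ.⊔ P) N≤o
      ≤K = ℕ.m⊔n≤o⇒m≤o K L ≤KL
      ≤L = ℕ.m⊔n≤o⇒n≤o K L ≤KL
      ≤M = ℕ.m⊔n≤o⇒m≤o M P ≤MP
      ≤P = ℕ.m⊔n≤o⇒n≤o M P ≤MP

open ProductLemmas

_*ᴿ_ : ℝ → ℝ → ℝ
x *ᴿ y = mkℝ (λ n → seq x n ℚ.* seq y n) (*-cauchy (seq x) (seq y) (cauchy x) (cauchy y))

IsSqrt : ℝ → ℝ → Set
IsSqrt s x = (fromℤ (+ 0) ≤ᴿ s) × (s *ᴿ s ≃ᴿ x)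

ℝ-rawRing : RawRing 0ℓ 0ℓ
ℝ-rawRing = record
  { Carrier = ℝ
  ; _≈_     = _≃ᴿ_
  ; _+_     = _+ᴿ_
  ; _*_     = _*ᴿ_
  ; -_      = -ᴿ_
  ; 0#      = fromℤ (+ 0)
  ; 1#      = fromℤ (+ 1)
  }

open RawRing ℝ-rawRing using (+-rawMonoid; *-rawMonoid; rawSemiring; 0#; 1#)
open RawMonoidDefs +-rawMonoid public using () renaming (sum to ∑)
open RawMonoidDefs *-rawMonoid public using () renaming (sum to ∏)
open RawSemiringDefs rawSemiring using (_^_)

Matrix : Set → ℕ → Set
Matrix A n = Fin n → Fin n → A

-- Laplace expansion along the first row.
det : ∀ {n} → Matrix ℝ n → ℝ
det {ℕ.zero} M = 1#
det {suc n}  M = ∑ λ j →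
  ((-ᴿ 1#) ^ toℕ j) *ᴿ (M zero j *ᴿ det (λ r c → M (suc r) (punchIn j c)))

J I : ∀ {n} → Matrix ℝ n
J _ _ = 1#
I i j = if does (i ≟ j) then 1# else 0#

-- ev lists the eigenvalues of M with multiplicity: the characteristic
-- polynomial det (xI − M) factors as ∏ᵢ (x − evᵢ).  Two real polynomials
-- are equal exactly when they agree at every real x.
IsSpectrum : ∀ {n} → Matrix ℝ n → Vector ℝ n → Set
IsSpectrum M ev = ∀ x →
  det (λ i j → x *ᴿ I i j -ᴿ M i j) ≃ᴿ ∏ (λ i → x -ᴿ ev i)

-- The vertices are numbered, so that V is Fin N; E is a finite set of
-- subsets of V, hence the list has no repetitions.
record Hypergraph (N : ℕ) : Set where
  field
    edges  : List (Subset N)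
    unique : Unique edges

open Hypergraph public

adjacency : ∀ {N} → Hypergraph N → Matrix ℕ N
adjacency G i j =
  if does (i ≟ j) then 0 else length (filter (⁅ i ⁆ ∪ ⁅ j ⁆ ⊆?_) (edges G))

seidel : ∀ {N} → Hypergraph N → Matrix ℝ N
seidel G i j = (J i j -ᴿ I i j) -ᴿ fromℤ (+ 2) *ᴿ fromℤ (+ adjacency G i j)

-- A relation rather than a function: a spectrum is unique up to reordering,
-- so at most one e (up to _≃ᴿ_) qualifies.
IsSeidelEnergy : ∀ {N} → Hypergraph N → ℝ → Set
IsSeidelEnergy {N} G e =
  Σ[ ev ∈ Vector ℝ N ] IsSpectrum (seidel G) ev × e ≃ᴿ ∑ (λ i → ∣ ev i ∣ᴿ)

-- The vertex v₀₀ is zero, and (with indices counted from 0) vᵢⱼ is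
-- suc (combine i j); quotient (k ∸ 1) recovers i from combine i j.
hyperstarEdge : ∀ n k → Fin (n ℕ.∸ 1) → Subset (suc ((n ℕ.∸ 1) ℕ.* (k ℕ.∸ 1)))
hyperstarEdge n k i =
  inside Vec.∷ Vec.tabulate (λ v → does (quotient (k ℕ.∸ 1) v ≟ i))

private
  hyperstarEdge-injective : ∀ n k → 2 ℕ.≤ k → ∀ {i i′} →
    hyperstarEdge n k i ≡ hyperstarEdge n k i′ → i ≡ i′
  hyperstarEdge-injective n (suc ℕ.zero) (ℕ.s≤s ())
  hyperstarEdge-injective n (suc (suc p)) _ {i} {i′} eq =
    decide (quotient (suc p) v ≟ i′) same
    where
    v : Fin ((n ℕ.∸ 1) ℕ.* suc p)
    v = combine i zero
    q≡i : quotient (suc p) v ≡ i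
    q≡i = cong proj₁ (remQuot-combine i (zero {p}))
    same : does (quotient (suc p) v ≟ i′) ≡ true
    same = trans (sym (lookup∘tabulate _ v))
          (trans (cong (λ e → Vec.lookup (Vec.tail e) v) (sym eq))
          (trans (lookup∘tabulate _ v) (dec-true (quotient (suc p) v ≟ i) q≡i)))
    decide : (d : Dec (quotient (suc p) v ≡ i′)) → does d ≡ true → i ≡ i′
    decide (yes q≡i′) _ = trans (sym q≡i) q≡i′

hyperstar : ∀ n k → 2 ℕ.≤ k → Hypergraph (suc ((n ℕ.∸ 1) ℕ.* (k ℕ.∸ 1)))
hyperstar n k 2≤k = record
  { edges  = tabulate (hyperstarEdge n k)
  ; unique = tabulate⁺ (hyperstarEdge-injective n k 2≤k)
  }

{-# OPTIONS --safe #-}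

-- Subtracting two adjacent rows of xI − S that belong to vertices of the same edge
-- leaves (x − 1)(e_r − e_{r+1}), and expanding along that row merges the two vertices
-- into one carrying both weights.  Merging every edge minus its centre gives (x − 1)^((n−1)(k−2))
-- times the determinant of a weighted quotient matrix.  After moving 2(k−1) to the
-- diagonal its leaves look alike, so they merge in turn with factor x − λ₂, where
-- λ₂ = 1 − 2(k−1), and a 2 × 2 determinant remains whose roots have opposite signs and
-- are (b ± √D)/2.  Real operations act termwise on Cauchy sequences, so all of this takes
-- place in ℚ; only the equation (√D)² = D is a statement about limits.

module Submission where

open import Defs
open import Algebra.Bundles using (CommutativeRing)
open import Algebra.Bundles.Raw using (RawRing)
import Algebra.Definitions.RawSemiring as RawSemiringDefs
import Algebra.Properties.CommutativeMonoid.Mult as CommutativeMonoidMult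
import Algebra.Properties.Semiring.Sum as SemiringSum
open import Data.Bool.Base using (true; false; if_then_else_)
open import Data.Fin.Base
  using (Fin; zero; suc; toℕ; inject₁; punchIn; punchOut; pinch; cast; quotient; _↑ˡ_; _↑ʳ_)
open import Data.Fin.Induction using (<-weakInduction)
open import Data.Fin.Properties
  using (_≟_; punchInᵢ≢i; punchIn-injective; punchIn-punchOut; toℕ-inject₁; suc-injective;
         cast-is-id; splitAt-↑ˡ; splitAt-↑ʳ)
open import Data.Fin.Subset using (_∈_; _⊆_; _∪_; ⁅_⁆)
open import Data.Fin.Subset.Properties using (_⊆?_; x∈p∪q⁺; x∈p∪q⁻; x∈⁅x⁆; x∈⁅y⁆⇒x≡y)
open import Data.Integer.Base as ℤ using (ℤ; -[1+_])
import Data.Integer.Properties as ℤ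
open import Data.List.Base using (List; []; _∷_; _++_; lookup; tabulate; replicate; length; filter)
open import Data.List.Properties
  using (length-tabulate; lookup-tabulate; tabulate-lookup; tabulate-cong; ++-assoc; ++-identityʳ;
         filter-accept; filter-reject; filter-none)
import Data.List.Relation.Unary.All.Properties as All
open import Data.Maybe.Base using (Maybe; just; nothing)
open import Data.Nat.Base as ℕ using (ℕ; zero; suc)
import Data.Nat.Properties as ℕ
open import Data.Product.Base using (Σ-syntax; ∃-syntax; _×_; _,_; proj₁; proj₂)
open import Data.Rational.Base as ℚ using (ℚ; mkℚ; 0ℚ; 1ℚ; ½)
import Data.Rational.Properties as ℚ
open import Data.Rational.Solver using (module +-*-Solver)
import Data.Rational.Unnormalised.Base as ℚᵘ
import Data.Rational.Unnormalised.Properties as ℚᵘ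
open import Data.Sum.Base using (inj₁; inj₂)
open import Data.Unit.Base using (⊤)
open import Data.Vec.Base as Vec using (Vec; []; _∷_; here; there)
import Data.Vec.Functional as Vector
open import Data.Vec.Functional.Properties using (updateAt-updates; updateAt-minimal)
open import Data.Vec.Properties using (lookup∘tabulate; []=⇒lookup; lookup⇒[]=)
open import Function.Base using (_∘_; const; case_of_)
open import Relation.Binary.PropositionalEquality
open import Relation.Nullary.Decidable using (Dec; does; yes; no; dec-true; dec-false)
open import Relation.Nullary.Negation using (¬_; contradiction)
open import Relation.Unary using (Decidable)

-- All matrices stay in one family: `y` times the identity plus couplings that depend only on
-- labels, each column scaled by a weight. A merge adds two weights and costs a factor `y`; nothing
-- is divided by `y`, so the identities also hold where `y` vanishes. The numbering puts the
-- non-central vertices of an edge side by side, so adjacent transpositions of rows suffice. The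
-- factorization is not exact at a single index of the Cauchy sequences, where an approximation `s`
-- stands for √D: there the two sides differ by a cofactor times s² - D, and only this difference
-- has to tend to 0. The remaining quadratic is x² - bx - W with W = (n-1)(k-1) and b = W + λ₂. Its
-- roots have product -W < 0, so their absolute values add up to √D whatever the sign of b.

-- Determinants over ℚ: row swaps, Laplace expansion and merging of two indices.

module Determinant where
  open import Data.Rational.Base using (_+_; _*_; _-_; -_)
  open import Data.Rational.Properties using (*-zeroˡ; *-identityˡ; +-identityʳ)
  open RawSemiringDefs (RawRing.rawSemiring ℚ.+-*-rawRing) using (_^_)
  open SemiringSum (CommutativeRing.semiring ℚ.+-*-commutativeRing)
    using (sum; sum-cong-≗; ∑-distrib-+; *-distribˡ-sum; sum-remove)
  open ≡-Reasoning

  δ : ∀ {n} → Fin n → Fin n → ℚ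
  δ i j = if does (i ≟ j) then 1ℚ else 0ℚ

  δ-refl : ∀ {n} (i : Fin n) → δ i i ≡ 1ℚ
  δ-refl i rewrite dec-true (i ≟ i) refl = refl

  δ-≢ : ∀ {n} {i j : Fin n} → i ≢ j → δ i j ≡ 0ℚ
  δ-≢ {i = i} {j} i≢j rewrite dec-false (i ≟ j) i≢j = refl

  ∑-δ : ∀ {n} (i : Fin n) (f : Fin n → ℚ) → sum (λ j → δ i j * f j) ≡ f i
  ∑-δ {suc n} i f = begin
    sum (λ j → δ i j * f j)                                     ≡⟨ sum-remove {i = i} (λ j → δ i j * f j) ⟩
    δ i i * f i + sum (λ j → δ i (punchIn i j) * f (punchIn i j))
      ≡⟨ cong₂ _+_ (trans (cong (_* f i) (δ-refl i)) (*-identityˡ (f i)))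
           (trans (sum-cong-≗ (λ j → trans
                    (cong (_* f (punchIn i j)) (δ-≢ (punchInᵢ≢i i j ∘ sym)))
                    (trans (*-zeroˡ (f (punchIn i j))) (sym (*-zeroˡ 0ℚ)))))
             (trans (sym (*-distribˡ-sum {n} 0ℚ (const 0ℚ))) (*-zeroˡ (sum {n} (const 0ℚ))))) ⟩
    f i + 0ℚ                                                    ≡⟨ +-identityʳ (f i) ⟩
    f i ∎

  sign : ∀ {n} → Fin n → ℚ
  sign j = (- 1ℚ) ^ toℕ j

  minor : ∀ {n} → Matrix ℚ (suc n) → Fin (suc n) → Fin (suc n) → Matrix ℚ n
  minor M r c i j = M (punchIn r i) (punchIn c j)

  detℚ : ∀ {n} → Matrix ℚ n → ℚ
  detℚ {zero}  M = 1ℚ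
  detℚ {suc n} M = sum λ j → sign j * (M zero j * detℚ (minor M zero j))

  detℚ-cong : ∀ {n} {A B : Matrix ℚ n} → (∀ i j → A i j ≡ B i j) → detℚ A ≡ detℚ B
  detℚ-cong {zero}  A≗B = refl
  detℚ-cong {suc n} A≗B = sum-cong-≗ λ j → cong (sign j *_)
    (cong₂ _*_ (A≗B zero j) (detℚ-cong λ i k → A≗B (suc i) (punchIn j k)))

  sum-neg : ∀ {n} (f : Fin n → ℚ) → sum (λ i → - f i) ≡ - sum f
  sum-neg {n} f = begin
    sum (λ i → - f i)        ≡⟨ sum-cong-≗ (λ i → neg (f i)) ⟩
    sum (λ i → - 1ℚ * f i)   ≡⟨ *-distribˡ-sum {n} (- 1ℚ) f ⟨
    - 1ℚ * sum f             ≡⟨ neg (sum f) ⟨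
    - sum f                  ∎
    where
    open +-*-Solver
    neg : ∀ x → - x ≡ - 1ℚ * x
    neg = solve 1 (λ x → :- x := con (- 1ℚ) :* x) refl

  -- (j , k) ↦ (punchIn j k , pinch k j) is the involution exchanging the two
  -- entries of an ordered pair of distinct indices (j , punchIn j k).
  ∑∑-exchange : ∀ {n} (f : Fin (suc n) → Fin n → ℚ) →
    sum (λ j → sum λ k → f (punchIn j k) (pinch k j)) ≡ sum (λ j → sum λ k → f j k)
  ∑∑-exchange {zero}  f = refl
  ∑∑-exchange {suc n} f = begin
    sum (λ k → f (suc k) zero) +
      sum (λ j → f zero j + sum (λ k → f (suc (punchIn j k)) (suc (pinch k j))))
      ≡⟨ cong (sum (λ k → f (suc k) zero) +_) (trans
           (∑-distrib-+ (f zero) (λ j → sum λ k → f (suc (punchIn j k)) (suc (pinch k j))))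
           (cong (sum (f zero) +_) (∑∑-exchange λ j k → f (suc j) (suc k)))) ⟩
    sum (λ k → f (suc k) zero) + (sum (f zero) + sum (λ j → sum λ k → f (suc j) (suc k)))
      ≡⟨ exch (sum λ k → f (suc k) zero) (sum (f zero)) (sum λ j → sum λ k → f (suc j) (suc k)) ⟩
    sum (f zero) + (sum (λ k → f (suc k) zero) + sum (λ j → sum λ k → f (suc j) (suc k)))
      ≡⟨ cong (sum (f zero) +_)
           (∑-distrib-+ (λ j → f (suc j) zero) (λ j → sum λ k → f (suc j) (suc k))) ⟨
    sum (f zero) + sum (λ j → f (suc j) zero + sum (λ k → f (suc j) (suc k))) ∎
    where
    open +-*-Solver
    exch : ∀ a b c → a + (b + c) ≡ b + (a + c)
    exch = solve 3 (λ a b c → a :+ (b :+ c) := b :+ (a :+ c)) refl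

  punchIn-exchange : ∀ {n} (j : Fin (suc n)) (k : Fin n) → punchIn (punchIn j k) (pinch k j) ≡ j
  punchIn-exchange zero    zero    = refl
  punchIn-exchange zero    (suc k) = refl
  punchIn-exchange (suc j) zero    = refl
  punchIn-exchange (suc j) (suc k) = cong suc (punchIn-exchange j k)

  -- Both sides enumerate the columns left after deleting the same two, so the second-order minor
  -- does not depend on the order of deletion.
  punchIn²-exchange : ∀ {n} (j : Fin (suc (suc n))) (k : Fin (suc n)) (c : Fin n) →
    punchIn (punchIn j k) (punchIn (pinch k j) c) ≡ punchIn j (punchIn k c)
  punchIn²-exchange zero    zero    c       = refl
  punchIn²-exchange zero    (suc k) c       = refl
  punchIn²-exchange (suc j) zero    c       = refl
  punchIn²-exchange (suc j) (suc k) zero    = refl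
  punchIn²-exchange (suc j) (suc k) (suc c) = cong suc (punchIn²-exchange j k c)

  -- Deleting the smaller column first shifts the larger one by one place; deleting the larger first
  -- shifts nothing. The exponents of the two orders therefore differ by one.
  sign-exchange : ∀ {n} (j : Fin (suc n)) (k : Fin n) →
    sign (punchIn j k) * sign (pinch k j) ≡ - (sign j * sign k)
  sign-exchange zero zero = refl
  sign-exchange zero (suc k) = solve 1 (λ s →
    con (- 1ℚ) :* (con (- 1ℚ) :* s) :* con 1ℚ := :- (con 1ℚ :* (con (- 1ℚ) :* s))) refl (sign k)
    where open +-*-Solver
  sign-exchange (suc j) zero = solve 1 (λ s →
    con 1ℚ :* s := :- (con (- 1ℚ) :* s :* con 1ℚ)) refl (sign j)
    where open +-*-Solver
  sign-exchange (suc j) (suc k) = begin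
    - 1ℚ * sign (punchIn j k) * (- 1ℚ * sign (pinch k j)) ≡⟨ cancel (sign (punchIn j k)) (sign (pinch k j)) ⟩
    sign (punchIn j k) * sign (pinch k j)                 ≡⟨ sign-exchange j k ⟩
    - (sign j * sign k)                                   ≡⟨ cong -_ (cancel (sign j) (sign k)) ⟨
    - (- 1ℚ * sign j * (- 1ℚ * sign k))                   ∎
    where
    open +-*-Solver
    cancel : ∀ a b → - 1ℚ * a * (- 1ℚ * b) ≡ a * b
    cancel = solve 2 (λ a b → con (- 1ℚ) :* a :* (con (- 1ℚ) :* b) := a :* b) refl

  -- Defined by recursion on `r`, so that at `suc r` it fixes row 0 definitionally and acts on the
  -- first-row minors as `swapAt r`.
  swapAt : ∀ {n} → Fin n → Fin (suc n) → Fin (suc n)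
  swapAt zero    zero          = suc zero
  swapAt zero    (suc zero)    = zero
  swapAt zero    (suc (suc i)) = suc (suc i)
  swapAt (suc r) zero          = zero
  swapAt (suc r) (suc i)       = suc (swapAt r i)

  swapAt-punchIn : ∀ {n} (r : Fin n) i → swapAt r (punchIn (inject₁ r) i) ≡ punchIn (suc r) i
  swapAt-punchIn zero    zero    = refl
  swapAt-punchIn zero    (suc i) = refl
  swapAt-punchIn (suc r) zero    = refl
  swapAt-punchIn (suc r) (suc i) = cong suc (swapAt-punchIn r i)

  swapAt-inject₁ : ∀ {n} (r : Fin n) → swapAt r (inject₁ r) ≡ suc r
  swapAt-inject₁ zero    = refl
  swapAt-inject₁ (suc r) = cong suc (swapAt-inject₁ r)

  swapAt-invariant : ∀ {n} {A : Set} (r : Fin n) (f : Fin (suc n) → A) →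
    f (inject₁ r) ≡ f (suc r) → ∀ i → f (swapAt r i) ≡ f i
  swapAt-invariant zero    f eq zero          = sym eq
  swapAt-invariant zero    f eq (suc zero)    = eq
  swapAt-invariant zero    f eq (suc (suc i)) = refl
  swapAt-invariant (suc r) f eq zero          = refl
  swapAt-invariant (suc r) f eq (suc i)       = swapAt-invariant r (f ∘ suc) eq i

  module _ {n} (M : Matrix ℚ (suc (suc n))) where
    -- The summand for the ordered pair of columns `(j , punchIn j k)` in the expansion along the
    -- first two rows.
    doubleTerm : Fin (suc (suc n)) → Fin (suc n) → ℚ
    doubleTerm j k = sign j * (M zero j * (sign k * (M (suc zero) (punchIn j k) *
      detℚ (minor (minor M zero j) zero k))))

    detℚ-double : detℚ M ≡ sum (λ j → sum (doubleTerm j))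
    detℚ-double = sum-cong-≗ λ j → trans
      (cong (sign j *_) (*-distribˡ-sum (M zero j) (entry j)))
      (*-distribˡ-sum (sign j) (λ k → M zero j * entry j k))
      where
      entry : Fin (suc (suc n)) → Fin (suc n) → ℚ
      entry j k = sign k * (M (suc zero) (punchIn j k) * detℚ (minor (minor M zero j) zero k))

  -- For the first two rows, the swap exchanges the columns of each ordered pair in the double
  -- expansion, which costs one sign, and the exchange is a reindexing of the double sum. Lower rows
  -- are swapped inside the minors.
  detℚ-swapAt : ∀ {n} (r : Fin n) (M : Matrix ℚ (suc n)) → detℚ (λ i → M (swapAt r i)) ≡ - detℚ M
  detℚ-swapAt {suc n} zero M = begin
    detℚ (λ i → M (swapAt zero i))
      ≡⟨ detℚ-double (λ i → M (swapAt zero i)) ⟩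
    sum (λ j → sum λ k → doubleTerm (λ i → M (swapAt zero i)) j k)
      ≡⟨ sum-cong-≗ (λ j → sum-cong-≗ λ k → swapped j k) ⟩
    sum (λ j → sum λ k → - doubleTerm M (punchIn j k) (pinch k j))
      ≡⟨ sum-cong-≗ (λ j → sum-neg (λ k → doubleTerm M (punchIn j k) (pinch k j))) ⟩
    sum (λ j → - sum λ k → doubleTerm M (punchIn j k) (pinch k j))
      ≡⟨ sum-neg (λ j → sum λ k → doubleTerm M (punchIn j k) (pinch k j)) ⟩
    - sum (λ j → sum λ k → doubleTerm M (punchIn j k) (pinch k j))
      ≡⟨ cong -_ (∑∑-exchange (doubleTerm M)) ⟩
    - sum (λ j → sum λ k → doubleTerm M j k)
      ≡⟨ cong -_ (detℚ-double M) ⟨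
    - detℚ M ∎
    where
    open +-*-Solver
    swapped : ∀ j k → doubleTerm (λ i → M (swapAt zero i)) j k ≡ - doubleTerm M (punchIn j k) (pinch k j)
    swapped j k = begin
      sign j * (M (suc zero) j * (sign k * (M zero (punchIn j k) * Δ)))
        ≡⟨ solve 5 (λ s t a b d → s :* (a :* (t :* (b :* d))) := :- (:- (s :* t)) :* (b :* (a :* d))) refl
             (sign j) (sign k) (M (suc zero) j) (M zero (punchIn j k)) Δ ⟩
      - (- (sign j * sign k)) * (M zero (punchIn j k) * (M (suc zero) j * Δ))
        ≡⟨ cong₂ (λ s q → - s * (M zero (punchIn j k) * q)) (sym (sign-exchange j k))
             (cong₂ _*_ (cong (M (suc zero)) (sym (punchIn-exchange j k)))
               (detℚ-cong λ i c → cong (M (suc (suc i))) (sym (punchIn²-exchange j k c)))) ⟩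
      - (sign (punchIn j k) * sign (pinch k j)) * (M zero (punchIn j k) *
        (M (suc zero) (punchIn (punchIn j k) (pinch k j)) * Δ′))
        ≡⟨ solve 5 (λ s t a b d → :- (s :* t) :* (a :* (b :* d)) := :- (s :* (a :* (t :* (b :* d))))) refl
             (sign (punchIn j k)) (sign (pinch k j)) (M zero (punchIn j k))
             (M (suc zero) (punchIn (punchIn j k) (pinch k j))) Δ′ ⟩
      - doubleTerm M (punchIn j k) (pinch k j) ∎
      where
      Δ = detℚ (minor (minor M zero j) zero k)
      Δ′ = detℚ (minor (minor M zero (punchIn j k)) zero (pinch k j))
  detℚ-swapAt {suc n} (suc r) M = begin
    sum (λ j → sign j * (M zero j * detℚ (λ i → minor M zero j (swapAt r i))))
      ≡⟨ sum-cong-≗ (λ j → trans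
           (cong (λ d → sign j * (M zero j * d)) (detℚ-swapAt r (minor M zero j)))
           (neg-out (sign j) (M zero j) (detℚ (minor M zero j)))) ⟩
    sum (λ j → - (sign j * (M zero j * detℚ (minor M zero j))))
      ≡⟨ sum-neg (λ j → sign j * (M zero j * detℚ (minor M zero j))) ⟩
    - detℚ M ∎
    where
    open +-*-Solver
    neg-out : ∀ s a d → s * (a * - d) ≡ - (s * (a * d))
    neg-out = solve 3 (λ s a d → s :* (a :* :- d) := :- (s :* (a :* d))) refl

  -- Swapping the equal rows changes nothing, so d = -d; the factor ½ turns this into d = 0.
  detℚ-alternating : ∀ {n} (r : Fin n) (M : Matrix ℚ (suc n)) →
    (∀ j → M (inject₁ r) j ≡ M (suc r) j) → detℚ M ≡ 0ℚ
  detℚ-alternating r M eq = begin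
    d             ≡⟨ solve 1 (λ d → d := con ½ :* (d :+ d)) refl d ⟩
    ½ * (d + d)   ≡⟨ cong (λ e → ½ * (e + d)) d≡-d ⟩
    ½ * (- d + d) ≡⟨ solve 1 (λ d → con ½ :* (:- d :+ d) := con 0ℚ) refl d ⟩
    0ℚ ∎
    where
    open +-*-Solver
    d = detℚ M
    d≡-d : d ≡ - d
    d≡-d = trans (detℚ-cong λ i j → sym (swapAt-invariant r (λ i → M i j) (eq j) i)) (detℚ-swapAt r M)

  -- Induction on the row: an adjacent swap brings row `r + 1` to place `r` without altering its
  -- minors, and the sign of the swap becomes the extra factor in `sign (suc r)`.
  detℚ-laplace : ∀ {n} (r : Fin (suc n)) (M : Matrix ℚ (suc n)) →
    detℚ M ≡ sum (λ j → sign r * sign j * (M r j * detℚ (minor M r j)))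
  detℚ-laplace {n} = <-weakInduction (λ r → ∀ M →
      detℚ M ≡ sum (λ j → sign r * sign j * (M r j * detℚ (minor M r j))))
    (λ M → sum-cong-≗ λ j → cong (_* (M zero j * detℚ (minor M zero j))) (sym (*-identityˡ (sign j))))
    step
    where
    open +-*-Solver
    step : ∀ r → _ → ∀ M → detℚ M ≡ sum (λ j → sign (suc r) * sign j * (M (suc r) j * detℚ (minor M (suc r) j)))
    step r expand M = begin
      detℚ M                  ≡⟨ solve 1 (λ d → d := :- (:- d)) refl (detℚ M) ⟩
      - (- detℚ M)            ≡⟨ cong -_ (detℚ-swapAt r M) ⟨
      - detℚ N                ≡⟨ cong -_ (expand N) ⟩
      - sum (λ j → sign (inject₁ r) * sign j * (N (inject₁ r) j * detℚ (minor N (inject₁ r) j)))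
        ≡⟨ sum-neg (λ j → sign (inject₁ r) * sign j * (N (inject₁ r) j * detℚ (minor N (inject₁ r) j))) ⟨
      sum (λ j → - (sign (inject₁ r) * sign j * (N (inject₁ r) j * detℚ (minor N (inject₁ r) j))))
        ≡⟨ sum-cong-≗ (λ j → trans
             (cong₂ (λ s e → - (s * sign j * e)) (cong ((- 1ℚ) ^_) (toℕ-inject₁ r))
               (cong₂ _*_ (cong (λ i → M i j) (swapAt-inject₁ r))
                 (detℚ-cong λ i k → cong (λ i → M i (punchIn j k)) (swapAt-punchIn r i))))
             (solve 3 (λ s t e → :- (s :* t :* e) := con (- 1ℚ) :* s :* t :* e) refl
               (sign r) (sign j) (M (suc r) j * detℚ (minor M (suc r) j)))) ⟩
      sum (λ j → sign (suc r) * sign j * (M (suc r) j * detℚ (minor M (suc r) j))) ∎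
      where
      N : Matrix ℚ (suc n)
      N i = M (swapAt r i)

  -- In the term of column `c` the minors avoid that column and agree, so the entries add. In any
  -- other term the entries agree and the minors add by induction, with `c` renumbered by
  -- `punchOut`.
  detℚ-column-+ : ∀ {n} (c : Fin n) {A B C : Matrix ℚ n} →
    (∀ i j → j ≢ c → A i j ≡ C i j) → (∀ i j → j ≢ c → B i j ≡ C i j) →
    (∀ i → A i c + B i c ≡ C i c) → detℚ A + detℚ B ≡ detℚ C
  detℚ-column-+ {suc n} c {A} {B} {C} A≗C B≗C A+B≗C = trans
    (sym (∑-distrib-+ (λ j → sign j * (A zero j * detℚ (minor A zero j)))
                      (λ j → sign j * (B zero j * detℚ (minor B zero j)))))
    (sum-cong-≗ term)
    where
    open +-*-Solver
    term : ∀ j → sign j * (A zero j * detℚ (minor A zero j)) + sign j * (B zero j * detℚ (minor B zero j))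
               ≡ sign j * (C zero j * detℚ (minor C zero j))
    term j with j ≟ c
    ... | yes refl = begin
      sign j * (A zero j * detℚ (minor A zero j)) + sign j * (B zero j * detℚ (minor B zero j))
        ≡⟨ cong₂ (λ d e → sign j * (A zero j * d) + sign j * (B zero j * e))
             (detℚ-cong λ i k → A≗C (suc i) (punchIn j k) (punchInᵢ≢i j k))
             (detℚ-cong λ i k → B≗C (suc i) (punchIn j k) (punchInᵢ≢i j k)) ⟩
      sign j * (A zero j * d) + sign j * (B zero j * d)
        ≡⟨ solve 4 (λ s a b d → s :* (a :* d) :+ s :* (b :* d) := s :* ((a :+ b) :* d)) refl
             (sign j) (A zero j) (B zero j) d ⟩
      sign j * ((A zero j + B zero j) * d)
        ≡⟨ cong (λ e → sign j * (e * d)) (A+B≗C zero) ⟩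
      sign j * (C zero j * d) ∎
      where d = detℚ (minor C zero j)
    ... | no j≢c = begin
      sign j * (A zero j * detℚ (minor A zero j)) + sign j * (B zero j * detℚ (minor B zero j))
        ≡⟨ cong₂ (λ a b → sign j * (a * detℚ (minor A zero j)) + sign j * (b * detℚ (minor B zero j)))
             (A≗C zero j j≢c) (B≗C zero j j≢c) ⟩
      sign j * (C zero j * detℚ (minor A zero j)) + sign j * (C zero j * detℚ (minor B zero j))
        ≡⟨ solve 4 (λ s c a b → s :* (c :* a) :+ s :* (c :* b) := s :* (c :* (a :+ b))) refl
             (sign j) (C zero j) (detℚ (minor A zero j)) (detℚ (minor B zero j)) ⟩
      sign j * (C zero j * (detℚ (minor A zero j) + detℚ (minor B zero j)))
        ≡⟨ cong (λ d → sign j * (C zero j * d)) (detℚ-column-+ (punchOut j≢c)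
             (λ i k k≢ → A≗C (suc i) (punchIn j k) (avoids k≢))
             (λ i k k≢ → B≗C (suc i) (punchIn j k) (avoids k≢))
             (λ i → subst (λ l → A (suc i) l + B (suc i) l ≡ C (suc i) l)
                (sym (punchIn-punchOut j≢c)) (A+B≗C (suc i)))) ⟩
      sign j * (C zero j * detℚ (minor C zero j)) ∎
      where
      avoids : ∀ {k} → k ≢ punchOut j≢c → punchIn j k ≢ c
      avoids {k} k≢ eq = k≢ (punchIn-injective j k (punchOut j≢c) (trans eq (sym (punchIn-punchOut j≢c))))

  -- This and the next two lemmas: deleting column `r` or column `r + 1` leaves lists of columns
  -- that differ only at position `r`.
  punchIn-inject₁-self : ∀ {n} (r : Fin n) → punchIn (inject₁ r) r ≡ suc r
  punchIn-inject₁-self zero    = refl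
  punchIn-inject₁-self (suc r) = cong suc (punchIn-inject₁-self r)

  punchIn-suc-self : ∀ {n} (r : Fin n) → punchIn (suc r) r ≡ inject₁ r
  punchIn-suc-self zero    = refl
  punchIn-suc-self (suc r) = cong suc (punchIn-suc-self r)

  punchIn-suc-≢ : ∀ {n} (r : Fin n) {j : Fin n} → j ≢ r → punchIn (suc r) j ≡ punchIn (inject₁ r) j
  punchIn-suc-≢ zero    {zero}  j≢r = contradiction refl j≢r
  punchIn-suc-≢ zero    {suc j} j≢r = refl
  punchIn-suc-≢ (suc r) {zero}  j≢r = refl
  punchIn-suc-≢ (suc r) {suc j} j≢r = cong suc (punchIn-suc-≢ r (j≢r ∘ cong suc))

  -- Subtracting row r + 1 from row r leaves y (e_r - e_{r+1}); the expansion along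
  -- that row is y times a sum of two minors differing only in column r.
  detℚ-merge : ∀ {n} (r : Fin n) (y : ℚ) (M : Matrix ℚ (suc n)) (N : Matrix ℚ n) →
    (∀ j → M (inject₁ r) j - M (suc r) j ≡ y * (δ (inject₁ r) j - δ (suc r) j)) →
    (∀ i j → j ≢ r → N i j ≡ M (punchIn (inject₁ r) i) (punchIn (inject₁ r) j)) →
    (∀ i → N i r ≡ M (punchIn (inject₁ r) i) (inject₁ r) + M (punchIn (inject₁ r) i) (suc r)) →
    detℚ M ≡ y * detℚ N
  detℚ-merge {n} r y M N rows cols col = begin
    detℚ M
      ≡⟨ solve 1 (λ d → d := d :+ (:- con 0ℚ)) refl (detℚ M) ⟩
    detℚ M - 0ℚ
      ≡⟨ cong₂ _-_ (detℚ-laplace a M) (trans (sym vanishing) (trans (detℚ-laplace a M′) (sum-cong-≗ λ j →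
           cong (λ e → sign a * sign j * e) (cong₂ _*_ (cong (λ f → f j) (updateAt-updates a {const (M b)} M))
             (detℚ-cong λ i k → cong (λ f → f (punchIn j k))
                (updateAt-minimal (punchIn a i) a {const (M b)} M (punchInᵢ≢i a i))))))) ⟩
    sum (λ j → sign a * sign j * (M a j * μ j)) - sum (λ j → sign a * sign j * (M b j * μ j))
      ≡⟨ sum-difference (λ j → sign a * sign j * (M a j * μ j)) (λ j → sign a * sign j * (M b j * μ j)) ⟩
    sum (λ j → sign a * sign j * (M a j * μ j) - sign a * sign j * (M b j * μ j))
      ≡⟨ sum-cong-≗ (λ j → trans (factor (sign a * sign j) (M a j) (M b j) (μ j))
           (trans (cong (λ e → sign a * sign j * (e * μ j)) (rows j))
             (distribute (sign a) (sign j) y (δ a j) (δ b j) (μ j)))) ⟩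
    sum (λ j → δ a j * (y * (sign a * sign j * μ j)) - δ b j * (y * (sign a * sign j * μ j)))
      ≡⟨ sum-difference (λ j → δ a j * (y * (sign a * sign j * μ j))) (λ j → δ b j * (y * (sign a * sign j * μ j))) ⟨
    sum (λ j → δ a j * (y * (sign a * sign j * μ j))) - sum (λ j → δ b j * (y * (sign a * sign j * μ j)))
      ≡⟨ cong₂ _-_ (∑-δ a λ j → y * (sign a * sign j * μ j)) (∑-δ b λ j → y * (sign a * sign j * μ j)) ⟩
    y * (sign a * sign a * μ a) - y * (sign a * sign b * μ b)
      ≡⟨ cong (λ s → y * (s * s * μ a) - y * (s * sign b * μ b)) (cong ((- 1ℚ) ^_) (toℕ-inject₁ r)) ⟩
    y * (sign r * sign r * μ a) - y * (sign r * (- 1ℚ * sign r) * μ b)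
      ≡⟨ solve 4 (λ y s u v → y :* (s :* s :* u) :- y :* (s :* (con (- 1ℚ) :* s) :* v) := s :* s :* (y :* (u :+ v)))
           refl y (sign r) (μ a) (μ b) ⟩
    sign r * sign r * (y * (μ a + μ b))
      ≡⟨ cong (_* (y * (μ a + μ b))) (sign-square (toℕ r)) ⟩
    1ℚ * (y * (μ a + μ b))
      ≡⟨ *-identityˡ (y * (μ a + μ b)) ⟩
    y * (μ a + μ b)
      ≡⟨ cong (y *_) (detℚ-column-+ r
           (λ i j j≢r → sym (cols i j j≢r))
           (λ i j j≢r → trans (cong (M (punchIn a i)) (punchIn-suc-≢ r j≢r)) (sym (cols i j j≢r)))
           (λ i → trans (cong₂ (λ j k → M (punchIn a i) j + M (punchIn a i) k)
                           (punchIn-inject₁-self r) (punchIn-suc-self r))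
                    (trans (solve 2 (λ u v → u :+ v := v :+ u) refl
                              (M (punchIn a i) b) (M (punchIn a i) a))
                      (sym (col i))))) ⟩
    y * detℚ N ∎
    where
    open +-*-Solver
    a b : Fin (suc n)
    a = inject₁ r
    b = suc r
    μ : Fin (suc n) → ℚ
    μ j = detℚ (minor M a j)
    -- With row `a` overwritten by row `b` the determinant vanishes, while its expansion along row
    -- `a` uses the cofactors of `M`. Subtracting this zero puts row differences in place of
    -- entries.
    M′ : Matrix ℚ (suc n)
    M′ = Vector.updateAt M a (const (M b))
    a≢b : ∀ {n} (r : Fin n) → suc r ≢ inject₁ r
    a≢b (suc r) eq = a≢b r (suc-injective eq)
    vanishing : detℚ M′ ≡ 0ℚ
    vanishing = detℚ-alternating r M′ λ j → trans
      (cong (λ f → f j) (updateAt-updates a {const (M b)} M))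
      (cong (λ f → f j) (sym (updateAt-minimal b a M (a≢b r))))
    sum-difference : ∀ {k} (f g : Fin k → ℚ) → sum f - sum g ≡ sum (λ j → f j - g j)
    sum-difference f g = trans (cong (sum f +_) (sym (sum-neg g))) (sym (∑-distrib-+ f (-_ ∘ g)))
    factor : ∀ s u v m → s * (u * m) - s * (v * m) ≡ s * ((u - v) * m)
    factor = solve 4 (λ s u v m → s :* (u :* m) :- s :* (v :* m) := s :* ((u :- v) :* m)) refl
    distribute : ∀ s t y d e m → s * t * (y * (d - e) * m) ≡ d * (y * (s * t * m)) - e * (y * (s * t * m))
    distribute = solve 6 (λ s t y d e m → s :* t :* (y :* (d :- e) :* m) :=
      d :* (y :* (s :* t :* m)) :- e :* (y :* (s :* t :* m))) refl
    sign-square : ∀ k → (- 1ℚ) ^ k * (- 1ℚ) ^ k ≡ 1ℚ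
    sign-square zero    = refl
    sign-square (suc k) = trans
      (solve 1 (λ s → con (- 1ℚ) :* s :* (con (- 1ℚ) :* s) := s :* s) refl ((- 1ℚ) ^ k)) (sign-square k)

-- Weighted quotient matrices and the merging of equally labelled indices.

module QuotientMatrix where
  open Determinant
  open import Data.Integer.Base using (+_)
  open import Data.Rational.Base using (_+_; _*_; _-_; -_)
  open import Data.Rational.Properties using (*-identityˡ; *-assoc; toℚᵘ-injective; toℚᵘ-fromℚᵘ; toℚᵘ-homo-+; toℚᵘ-homo-*; toℚᵘ-homo‿-)
  open RawSemiringDefs (RawRing.rawSemiring ℚ.+-*-rawRing) using (_^_)
  open ≡-Reasoning

  ι : ℤ → ℚ
  ι z = z ℚ./ 1

  module _ where
    private
      -- `ι` normalises by a gcd, which is stuck on variables; the homomorphism laws are therefore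
      -- proved on unnormalised fractions with denominator 1.
      toℚᵘ-ι : ∀ z → ℚ.toℚᵘ (ι z) ℚᵘ.≃ ℚᵘ.mkℚᵘ z 0
      toℚᵘ-ι z = toℚᵘ-fromℚᵘ (ℚᵘ.mkℚᵘ z 0)

    ι-+ : ∀ a b → ι (a ℤ.+ b) ≡ ι a + ι b
    ι-+ a b = toℚᵘ-injective (ℚᵘ.≃-trans (toℚᵘ-ι (a ℤ.+ b)) (ℚᵘ.≃-trans
      (ℚᵘ.*≡* (cong (ℤ._* + 1) (sym (cong₂ ℤ._+_ (ℤ.*-identityʳ a) (ℤ.*-identityʳ b)))))
      (ℚᵘ.≃-sym (ℚᵘ.≃-trans (toℚᵘ-homo-+ (ι a) (ι b)) (ℚᵘ.+-cong (toℚᵘ-ι a) (toℚᵘ-ι b))))))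

    ι-* : ∀ a b → ι (a ℤ.* b) ≡ ι a * ι b
    ι-* a b = toℚᵘ-injective (ℚᵘ.≃-trans (toℚᵘ-ι (a ℤ.* b))
      (ℚᵘ.≃-sym (ℚᵘ.≃-trans (toℚᵘ-homo-* (ι a) (ι b)) (ℚᵘ.*-cong (toℚᵘ-ι a) (toℚᵘ-ι b)))))

    ι-neg : ∀ a → ι (ℤ.- a) ≡ - ι a
    ι-neg a = toℚᵘ-injective (ℚᵘ.≃-trans (toℚᵘ-ι (ℤ.- a))
      (ℚᵘ.≃-sym (ℚᵘ.≃-trans (toℚᵘ-homo‿- (ι a)) (ℚᵘ.-‿cong (toℚᵘ-ι a)))))

  δ-punchIn : ∀ {n} (a : Fin (suc n)) i j → δ (punchIn a i) (punchIn a j) ≡ δ i j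
  δ-punchIn a i j with i ≟ j
  ... | yes refl = δ-refl (punchIn a i)
  ... | no i≢j   = δ-≢ (i≢j ∘ punchIn-injective a i j)

  tabulate-+ : ∀ {A : Set} m {n} (f : Fin (m ℕ.+ n) → A) →
    tabulate f ≡ tabulate (λ i → f (i ↑ˡ n)) ++ tabulate (λ j → f (m ↑ʳ j))
  tabulate-+ zero    f = refl
  tabulate-+ (suc m) f = cong (f zero ∷_) (tabulate-+ m (f ∘ suc))

  tabulate-const : ∀ {A : Set} n (x : A) → tabulate {n = n} (const x) ≡ replicate n x
  tabulate-const zero    x = refl
  tabulate-const (suc n) x = cong (x ∷_) (tabulate-const n x)

  -- The numbering by `combine` makes `quotient` constant on consecutive blocks of length `k`; this
  -- splits off the first block.
  tabulate-quotient : ∀ {A : Set} {m} k (f : Fin (suc m) → A) →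
    tabulate (λ v → f (quotient {suc m} k v)) ≡ replicate k (f zero) ++ tabulate (λ v → f (suc (quotient {m} k v)))
  tabulate-quotient {m = m} k f = trans (tabulate-+ k (λ v → f (quotient {suc m} k v))) (cong₂ _++_
    (trans (tabulate-cong λ i → cong f (quotient-↑ˡ i)) (tabulate-const k (f zero)))
    (tabulate-cong λ v → cong f (quotient-↑ʳ v)))
    where
    quotient-↑ˡ : ∀ i → quotient {suc m} k (i ↑ˡ (m ℕ.* k)) ≡ zero
    quotient-↑ˡ i rewrite splitAt-↑ˡ k i (m ℕ.* k) = refl
    quotient-↑ʳ : ∀ v → quotient {suc m} k (k ↑ʳ v) ≡ suc (quotient {m} k v)
    quotient-↑ʳ v rewrite splitAt-↑ʳ k (m ℕ.* k) v = refl

  module Quotient {B : Set} (c : B → B → ℚ) (y : ℚ) where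

    -- The weight of an index counts the vertices already merged into it. It scales the column only,
    -- since a merge adds two columns but keeps a single row.
    K : ∀ {n} → (Fin n → B × ℚ) → Matrix ℚ n
    K v i j = y * δ i j + proj₂ (v j) * c (proj₁ (v i)) (proj₁ (v j))

    -- Lists let the size shrink with each merge and locate the merged pair by `++` instead of by
    -- index arithmetic.
    detK : List (B × ℚ) → ℚ
    detK l = detℚ (K (lookup l))

    detℚ-K-cast : ∀ {m n} (e : m ≡ n) (v : Fin m → B × ℚ) (w : Fin n → B × ℚ) →
      (∀ i → w (cast e i) ≡ v i) → detℚ (K w) ≡ detℚ (K v)
    detℚ-K-cast refl v w eq = detℚ-cong λ i j →
      cong₂ (λ a b → y * δ i j + proj₂ b * c (proj₁ a) (proj₁ b)) (eq′ i) (eq′ j)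
      where
      eq′ : ∀ i → w i ≡ v i
      eq′ i = trans (cong w (sym (cast-is-id refl i))) (eq i)

    detK-tabulate : ∀ {n} (v : Fin n → B × ℚ) → detK (tabulate v) ≡ detℚ (K v)
    detK-tabulate v = detℚ-K-cast (sym (length-tabulate v)) v (lookup (tabulate v)) (lookup-tabulate v)

    -- A relation between functions, so that evidence for a merge can be shifted one place when an
    -- element is put in front.
    record Merges {n} (r : Fin n) (v : Fin (suc n) → B × ℚ) (w : Fin n → B × ℚ) : Set where
      field
        same-label : proj₁ (v (inject₁ r)) ≡ proj₁ (v (suc r))
        labels     : ∀ j → proj₁ (w j) ≡ proj₁ (v (punchIn (inject₁ r) j))
        weights    : ∀ j → j ≢ r → proj₂ (w j) ≡ proj₂ (v (punchIn (inject₁ r) j))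
        weight     : proj₂ (w r) ≡ proj₂ (v (inject₁ r)) + proj₂ (v (suc r))

    -- Rows with equal labels have equal couplings, so their difference retains only the part
    -- `y * δ`; columns with equal labels add by adding weights.
    detℚ-K-merge : ∀ {n} {r : Fin n} {v w} → Merges r v w → detℚ (K v) ≡ y * detℚ (K w)
    detℚ-K-merge {n} {r} {v} {w} merges = detℚ-merge r y (K v) (K w) rows cols col
      where
      open Merges merges
      open +-*-Solver
      a b : Fin (suc n)
      a = inject₁ r
      b = suc r
      L : Fin (suc n) → B
      L = proj₁ ∘ v
      W : Fin (suc n) → ℚ
      W = proj₂ ∘ v
      rows : ∀ j → K v a j - K v b j ≡ y * (δ a j - δ b j)
      rows j = trans
        (cong (λ l → K v a j - (y * δ b j + W j * c l (L j))) (sym same-label))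
        (solve 4 (λ y d e t → (y :* d :+ t) :- (y :* e :+ t) := y :* (d :- e)) refl
          y (δ a j) (δ b j) (W j * c (L a) (L j)))
      cols : ∀ i j → j ≢ r → K w i j ≡ K v (punchIn a i) (punchIn a j)
      cols i j j≢r = cong₂ _+_ (cong (y *_) (sym (δ-punchIn a i j)))
        (cong₂ _*_ (weights j j≢r) (cong₂ c (labels i) (labels j)))
      col : ∀ i → K w i r ≡ K v (punchIn a i) a + K v (punchIn a i) b
      col i = begin
        y * δ i r + proj₂ (w r) * c (proj₁ (w i)) (proj₁ (w r))
          ≡⟨ cong₂ (λ u l → y * δ i r + u * c l (proj₁ (w r))) weight (labels i) ⟩
        y * δ i r + (W a + W b) * c l (proj₁ (w r))
          ≡⟨ cong (λ l′ → y * δ i r + (W a + W b) * c l l′) (trans (labels r) (cong L (punchIn-inject₁-self r))) ⟩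
        y * δ i r + (W a + W b) * c l (L b)
          -- The inserted `y * 0ℚ` is the diagonal part of column `a`, which no row `punchIn a i`
          -- meets.
          ≡⟨ solve 5 (λ y d u t s → y :* d :+ (u :+ t) :* s := (y :* con 0ℚ :+ u :* s) :+ (y :* d :+ t :* s)) refl
               y (δ i r) (W a) (W b) (c l (L b)) ⟩
        (y * 0ℚ + W a * c l (L b)) + (y * δ i r + W b * c l (L b))
          ≡⟨ cong₂ (λ d e → (y * d + W a * c l (L b)) + (y * e + W b * c l (L b)))
               (sym (δ-≢ (punchInᵢ≢i a i)))
               (trans (sym (δ-punchIn a i r)) (cong (δ (punchIn a i)) (punchIn-inject₁-self r))) ⟩
        (y * δ (punchIn a i) a + W a * c l (L b)) + K v (punchIn a i) b
          ≡⟨ cong (λ l′ → (y * δ (punchIn a i) a + W a * c l l′) + K v (punchIn a i) b) same-label ⟨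
        K v (punchIn a i) a + K v (punchIn a i) b ∎
        where l = L (punchIn a i)

    -- Size and position remain existential, and the lists appear as tabulations, so prefixing `x`
    -- is `Vector.∷` and no cast of indices arises.
    merges-++ : ∀ l b w u r → ∃[ n ] Σ[ i ∈ Fin n ] ∃[ v ] ∃[ v′ ]
      tabulate v ≡ l ++ (b , w) ∷ (b , u) ∷ r × tabulate v′ ≡ l ++ (b , w + u) ∷ r × Merges i v v′
    merges-++ [] b w u r =
        _ , zero , lookup ((b , w) ∷ (b , u) ∷ r) , lookup ((b , w + u) ∷ r)
      , tabulate-lookup ((b , w) ∷ (b , u) ∷ r) , tabulate-lookup ((b , w + u) ∷ r) , record
      { same-label = refl
      ; labels     = λ { zero → refl ; (suc j) → refl }
      ; weights    = λ { zero 0≢0 → contradiction refl 0≢0 ; (suc j) _ → refl }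
      ; weight     = refl
      }
    merges-++ (x ∷ l) b w u r with merges-++ l b w u r
    ... | n , i , v , v′ , eq , eq′ , merges = suc n , suc i , x Vector.∷ v , x Vector.∷ v′
      , cong (x ∷_) eq , cong (x ∷_) eq′ , record
      { same-label = same-label
      ; labels     = λ { zero → refl ; (suc j) → labels j }
      ; weights    = λ { zero _ → refl ; (suc j) j≢i → weights j (j≢i ∘ cong suc) }
      ; weight     = weight
      }
      where open Merges merges

    detK-merge : ∀ l b w u r → detK (l ++ (b , w) ∷ (b , u) ∷ r) ≡ y * detK (l ++ (b , w + u) ∷ r)
    detK-merge l b w u r with merges-++ l b w u r
    ... | n , i , v , v′ , eq , eq′ , merges = begin
      detK (l ++ (b , w) ∷ (b , u) ∷ r)  ≡⟨ cong detK eq ⟨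
      detK (tabulate v)                  ≡⟨ detK-tabulate v ⟩
      detℚ (K v)                         ≡⟨ detℚ-K-merge merges ⟩
      y * detℚ (K v′)                    ≡⟨ cong (y *_) (detK-tabulate v′) ⟨
      y * detK (tabulate v′)             ≡⟨ cong (λ l → y * detK l) eq′ ⟩
      y * detK (l ++ (b , w + u) ∷ r)    ∎

    -- The head accumulates weight while absorbing its copies, hence its weight `w` has to be
    -- independent of `u`.
    detK-replicate : ∀ l b w u q r → detK (l ++ (b , w) ∷ replicate q (b , u) ++ r)
      ≡ y ^ q * detK (l ++ (b , w + ι (+ q) * u) ∷ r)
    detK-replicate l b w u zero r = begin
      detK (l ++ (b , w) ∷ r)
        ≡⟨ cong (λ w → detK (l ++ (b , w) ∷ r))
             (solve 2 (λ w u → w := w :+ con 0ℚ :* u) refl w u) ⟩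
      detK (l ++ (b , w + 0ℚ * u) ∷ r)
        ≡⟨ *-identityˡ (detK (l ++ (b , w + 0ℚ * u) ∷ r)) ⟨
      1ℚ * detK (l ++ (b , w + 0ℚ * u) ∷ r) ∎
      where open +-*-Solver
    detK-replicate l b w u (suc q) r = begin
      detK (l ++ (b , w) ∷ (b , u) ∷ replicate q (b , u) ++ r)
        ≡⟨ detK-merge l b w u (replicate q (b , u) ++ r) ⟩
      y * detK (l ++ (b , w + u) ∷ replicate q (b , u) ++ r)
        ≡⟨ cong (y *_) (detK-replicate l b (w + u) u q r) ⟩
      y * (y ^ q * detK (l ++ (b , w + u + ι (+ q) * u) ∷ r))
        ≡⟨ *-assoc y (y ^ q) _ ⟨
      y ^ suc q * detK (l ++ (b , w + u + ι (+ q) * u) ∷ r)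
        ≡⟨ cong (λ w → y ^ suc q * detK (l ++ (b , w) ∷ r)) (trans
             (solve 3 (λ w u q → w :+ u :+ q :* u := w :+ (con 1ℚ :+ q) :* u) refl w u (ι (+ q)))
             (cong (λ q → w + q * u) (sym (ι-+ (+ 1) (+ q))))) ⟩
      y ^ suc q * detK (l ++ (b , w + ι (+ suc q) * u) ∷ r) ∎
      where open +-*-Solver

    -- The prefix `l` is arbitrary because each block, once merged, passes into the prefix for the
    -- next one.
    detK-blocks : ∀ l m q (g : Fin m → B) →
      detK (l ++ tabulate (λ v → g (quotient {m} (suc q) v) , 1ℚ))
        ≡ (y ^ q) ^ m * detK (l ++ tabulate (λ i → g i , ι (+ suc q)))
    detK-blocks l zero    q g = sym (*-identityˡ (detK (l ++ [])))
    detK-blocks l (suc m) q g = begin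
      detK (l ++ tabulate (λ v → g (quotient {suc m} (suc q) v) , 1ℚ))
        ≡⟨ cong (λ r → detK (l ++ r)) (tabulate-quotient {m = m} (suc q) (λ i → g i , 1ℚ)) ⟩
      detK (l ++ (g zero , 1ℚ) ∷ replicate q (g zero , 1ℚ) ++ tabulate (λ v → g (suc (quotient {m} (suc q) v)) , 1ℚ))
        ≡⟨ detK-replicate l (g zero) 1ℚ 1ℚ q (tabulate (λ v → g (suc (quotient {m} (suc q) v)) , 1ℚ)) ⟩
      y ^ q * detK (l ++ (g zero , 1ℚ + ι (+ q) * 1ℚ) ∷ tabulate (λ v → g (suc (quotient {m} (suc q) v)) , 1ℚ))
        ≡⟨ cong (y ^ q *_) (trans
             (cong (λ w → detK (l ++ (g zero , w) ∷ rest)) (trans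
                (solve 1 (λ q → con 1ℚ :+ q :* con 1ℚ := con 1ℚ :+ q) refl (ι (+ q))) (sym (ι-+ (+ 1) (+ q)))))
             (cong detK (sym (++-assoc l (x ∷ []) rest)))) ⟩
      y ^ q * detK ((l ++ x ∷ []) ++ rest)
        ≡⟨ cong (y ^ q *_) (detK-blocks (l ++ x ∷ []) m q (g ∘ suc)) ⟩
      y ^ q * ((y ^ q) ^ m * detK ((l ++ x ∷ []) ++ tabulate (λ i → g (suc i) , ι (+ suc q))))
        ≡⟨ *-assoc (y ^ q) ((y ^ q) ^ m) _ ⟨
      (y ^ q) ^ suc m * detK ((l ++ x ∷ []) ++ tabulate (λ i → g (suc i) , ι (+ suc q)))
        ≡⟨ cong (λ l → (y ^ q) ^ suc m * detK l) (++-assoc l (x ∷ []) _) ⟩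
      (y ^ q) ^ suc m * detK (l ++ tabulate (λ i → g i , ι (+ suc q))) ∎
      where
      open +-*-Solver
      x = (g zero , ι (+ suc q))
      rest = tabulate (λ v → g (suc (quotient {m} (suc q) v)) , 1ℚ)

-- Square roots of rationals as Cauchy sequences, by bisection.

module SquareRoot where
  open QuotientMatrix using (ι; ι-+)
  open import Data.Integer.Base using (+_)
  open import Data.Rational.Base using (_+_; _*_; _-_; -_; _≤_; _<_; ∣_∣; 1/_; nonNegative)
  open import Data.Rational.Properties
  open RawSemiringDefs (RawRing.rawSemiring ℚ.+-*-rawRing) using (_^_)

  0≤-+ : ∀ {p q} → 0ℚ ≤ p → 0ℚ ≤ q → 0ℚ ≤ p + q
  0≤-+ 0≤p 0≤q = +-mono-≤ 0≤p 0≤q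

  0≤-* : ∀ {p q} → 0ℚ ≤ p → 0ℚ ≤ q → 0ℚ ≤ p * q
  0≤-* {p} {q} 0≤p 0≤q = nonNegative⁻¹ (p * q) {{nonNeg*nonNeg⇒nonNeg p {{nonNegative 0≤p}} q {{nonNegative 0≤q}}}}

  ≤-difference : ∀ {p q} d → 0ℚ ≤ d → p + d ≡ q → p ≤ q
  ≤-difference {p} d 0≤d refl = subst (_≤ p + d) (+-identityʳ p) (+-monoʳ-≤ p 0≤d)

  ∣p∣≤ : ∀ {p e} → p ≤ e → - p ≤ e → ∣ p ∣ ≤ e
  ∣p∣≤ {p} {e} p≤e -p≤e with ∣p∣≡p∨∣p∣≡-p p
  ... | inj₁ eq = subst (_≤ e) (sym eq) p≤e
  ... | inj₂ eq = subst (_≤ e) (sym eq) -p≤e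

  ∣p-q∣≤width : ∀ {l h p q} → l ≤ p → p ≤ h → l ≤ q → q ≤ h → ∣ p - q ∣ ≤ h - l
  ∣p-q∣≤width {l} {h} {p} {q} l≤p p≤h l≤q q≤h = ∣p∣≤ (+-mono-≤ p≤h (neg-antimono-≤ l≤q))
    (subst (_≤ h - l) (solve 2 (λ p q → q :- p := :- (p :- q)) refl p q) (+-mono-≤ q≤h (neg-antimono-≤ l≤p)))
    where open +-*-Solver

  -- Denominators are at least 1, so the absolute value of the numerator plus 1 is a strict bound.
  archimedean : ∀ p → ∃[ n ] p < ι (+ n)
  archimedean p = suc ℤ.∣ ℚ.↥ p ∣ , toℚᵘ-cancel-< (ℚᵘ.<-respʳ-≃
    (ℚᵘ.≃-sym (toℚᵘ-fromℚᵘ (ℚᵘ.mkℚᵘ (+ suc ℤ.∣ ℚ.↥ p ∣) 0))) (below p))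
    where
    below : ∀ p → ℚ.toℚᵘ p ℚᵘ.< ℚᵘ.mkℚᵘ (+ suc ℤ.∣ ℚ.↥ p ∣) 0
    below (mkℚ (+ m)    d _) = ℚᵘ.*<* (subst₂ ℤ._<_ (sym (ℤ.*-identityʳ (+ m))) (ℤ.pos-* (suc m) (suc d))
      (ℤ.+<+ (ℕ.<-≤-trans (ℕ.n<1+n m) (ℕ.m≤m*n (suc m) (suc d)))))
    below (mkℚ -[1+ m ] d _) = ℚᵘ.*<* ℤ.-<+

  ½^-positive : ∀ n → 0ℚ < ½ ^ n
  ½^-positive zero    = positive⁻¹ 1ℚ
  ½^-positive (suc n) = CauchyLemmas.half-pos (½^-positive n)

  0≤ι : ∀ n → 0ℚ ≤ ι (+ n)
  0≤ι zero    = ≤-refl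
  0≤ι (suc n) = subst (0ℚ ≤_) (sym (ι-+ (+ 1) (+ n))) (0≤-+ (<⇒≤ (positive⁻¹ 1ℚ)) (0≤ι n))

  ½^n≤1 : ∀ n → ½ ^ n ≤ 1ℚ
  ½^n≤1 zero    = ≤-refl
  ½^n≤1 (suc n) = ≤-trans (*-monoˡ-≤-nonNeg ½ (½^n≤1 n)) (≤-difference ½ (<⇒≤ (positive⁻¹ ½)) refl)

  -- (n+1)/2ⁿ⁺¹ is the average of 1/2ⁿ and n/2ⁿ, both at most 1.
  ½^n*n≤1 : ∀ n → ½ ^ n * ι (+ n) ≤ 1ℚ
  ½^n*n≤1 zero    = ≤-difference 1ℚ (<⇒≤ (positive⁻¹ 1ℚ)) refl
  ½^n*n≤1 (suc n) = subst₂ _≤_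
    (trans (solve 2 (λ h k → con ½ :* h :+ con ½ :* (h :* k) := con ½ :* h :* (con 1ℚ :+ k)) refl (½ ^ n) (ι (+ n)))
      (cong (½ ^ suc n *_) (sym (ι-+ (+ 1) (+ n)))))
    refl
    (+-mono-≤ (*-monoˡ-≤-nonNeg ½ (½^n≤1 n)) (*-monoˡ-≤-nonNeg ½ (½^n*n≤1 n)))
    where open +-*-Solver

  ι-mono : ∀ {m n} → m ℕ.≤ n → ι (+ m) ≤ ι (+ n)
  ι-mono {m} {n} m≤n = ≤-difference (ι (+ (n ℕ.∸ m))) (0≤ι (n ℕ.∸ m))
    (trans (sym (ι-+ (+ m) (+ (n ℕ.∸ m)))) (cong (ι ∘ +_) (ℕ.m+[n∸m]≡n m≤n)))

  ½^-vanishes : ∀ C ε → 0ℚ < ε → ∃[ N ] ∀ n → N ℕ.≤ n → ½ ^ n * C < ε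
  -- Any N above C/ε serves: for n ≥ N, C/2ⁿ < Nε/2ⁿ ≤ nε/2ⁿ ≤ ε.
  ½^-vanishes C ε 0<ε with archimedean (C * 1/ε)
    where
    1/ε = (1/ ε) {{pos⇒nonZero ε {{ℚ.positive 0<ε}}}}
  ... | N , C/ε<N = N , λ n N≤n → begin-strict
    ½ ^ n * C                          <⟨ *-monoʳ-<-pos (½ ^ n) {{ℚ.positive (½^-positive n)}} C<Nε ⟩
    ½ ^ n * (ι (+ N) * ε)              ≡⟨ *-assoc (½ ^ n) (ι (+ N)) ε ⟨
    ½ ^ n * ι (+ N) * ε                ≤⟨ *-monoʳ-≤-nonNeg ε (*-monoˡ-≤-nonNeg (½ ^ n) {{nonNegative (<⇒≤ (½^-positive n))}} (ι-mono N≤n)) ⟩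
    ½ ^ n * ι (+ n) * ε                ≤⟨ *-monoʳ-≤-nonNeg ε (½^n*n≤1 n) ⟩
    1ℚ * ε                             ≡⟨ *-identityˡ ε ⟩
    ε                                  ∎
    where
    open ≤-Reasoning
    instance
      ε>0 = ℚ.positive 0<ε
      ε≥0 = pos⇒nonNeg ε
      ε≢0 = pos⇒nonZero ε
    C<Nε : C < ι (+ N) * ε
    C<Nε = subst (_< ι (+ N) * ε)
      (trans (*-assoc C (1/ ε) ε) (trans (cong (C *_) (*-inverseˡ ε)) (*-identityʳ C)))
      (*-monoˡ-<-pos ε C/ε<N)

  -- s n ≤ √D ≤ s n + gap n, and gap is halved at every step.
  module Bisection (a D : ℚ) (0≤a : 0ℚ ≤ a) (a²≤D : a * a ≤ D) where
    -- The initial width D + 1 is at least √D, because D ≤ (D + 1)²; so the first interval reaches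
    -- √D from any starting point `a` ≥ 0.
    gap : ℕ → ℚ
    gap n = ½ ^ n * (D + 1ℚ)

    -- The decision is an argument, so a `with` on the same comparison makes `s (suc n)` reduce.
    step : ∀ s d → Dec ((s + d) * (s + d) ≤ D) → ℚ
    step s d (yes _) = s + d
    step s d (no _)  = s

    s : ℕ → ℚ
    s zero    = a
    s (suc n) = step (s n) (gap (suc n)) ((s n + gap (suc n)) * (s n + gap (suc n)) ≤? D)

    0≤D : 0ℚ ≤ D
    0≤D = ≤-trans (0≤-* 0≤a 0≤a) a²≤D

    0≤D+1 : 0ℚ ≤ D + 1ℚ
    0≤D+1 = 0≤-+ 0≤D (<⇒≤ (positive⁻¹ 1ℚ))

    0≤gap : ∀ n → 0ℚ ≤ gap n
    0≤gap n = 0≤-* (<⇒≤ (½^-positive n)) 0≤D+1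

    gap-half : ∀ n → gap n ≡ gap (suc n) + gap (suc n)
    gap-half n = solve 2 (λ h c → h :* c := con ½ :* h :* c :+ con ½ :* h :* c) refl (½ ^ n) (D + 1ℚ)
      where open +-*-Solver

    s-increasing : ∀ n → s n ≤ s (suc n)
    s-increasing n with (s n + gap (suc n)) * (s n + gap (suc n)) ≤? D
    ... | yes _ = ≤-difference (gap (suc n)) (0≤gap (suc n)) refl
    ... | no  _ = ≤-refl

    s+gap-decreasing : ∀ n → s (suc n) + gap (suc n) ≤ s n + gap n
    s+gap-decreasing n with (s n + gap (suc n)) * (s n + gap (suc n)) ≤? D
    ... | yes _ = ≤-reflexive (trans (+-assoc (s n) (gap (suc n)) (gap (suc n))) (cong (λ t → s n + t) (sym (gap-half n))))
    ... | no  _ = +-monoʳ-≤ (s n) (≤-difference (gap (suc n)) (0≤gap (suc n)) (sym (gap-half n)))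

    s²≤D : ∀ n → s n * s n ≤ D
    s²≤D zero    = a²≤D
    s²≤D (suc n) with (s n + gap (suc n)) * (s n + gap (suc n)) ≤? D
    ... | yes ≤D = ≤D
    ... | no  _  = s²≤D n

    D≤[s+gap]² : ∀ n → D ≤ (s n + gap n) * (s n + gap n)
    D≤[s+gap]² zero    = ≤-difference (a * a + (a + a) * (D + 1ℚ) + D * D + (D + 1ℚ))
      (0≤-+ (0≤-+ (0≤-+ (0≤-* 0≤a 0≤a) (0≤-* (0≤-+ 0≤a 0≤a) 0≤D+1)) (0≤-* 0≤D 0≤D)) 0≤D+1)
      (solve 2 (λ a D → D :+ (a :* a :+ (a :+ a) :* (D :+ con 1ℚ) :+ D :* D :+ (D :+ con 1ℚ)) :=
         (a :+ con 1ℚ :* (D :+ con 1ℚ)) :* (a :+ con 1ℚ :* (D :+ con 1ℚ))) refl a D)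
      where open +-*-Solver
    D≤[s+gap]² (suc n) with (s n + gap (suc n)) * (s n + gap (suc n)) ≤? D
    ... | yes _ = subst (λ t → D ≤ t * t)
      (trans (cong (λ t → s n + t) (gap-half n)) (sym (+-assoc (s n) (gap (suc n)) (gap (suc n))))) (D≤[s+gap]² n)
    ... | no ≰D = <⇒≤ (≰⇒> ≰D)

    s-mono : ∀ {m n} → m ℕ.≤ n → s m ≤ s n
    s-mono = go ∘ ℕ.≤⇒≤′
      where
      go : ∀ {m n} → m ℕ.≤′ n → s m ≤ s n
      go ℕ.≤′-refl                   = ≤-refl
      go {n = suc n} (ℕ.≤′-step m≤n) = ≤-trans (go m≤n) (s-increasing n)

    s≤s+gap : ∀ {m n} → m ℕ.≤ n → s n ≤ s m + gap m
    s≤s+gap = go ∘ ℕ.≤⇒≤′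
      where
      antitone : ∀ {m n} → m ℕ.≤′ n → s n + gap n ≤ s m + gap m
      antitone ℕ.≤′-refl                   = ≤-refl
      antitone {n = suc n} (ℕ.≤′-step m≤n) = ≤-trans (s+gap-decreasing n) (antitone m≤n)
      go : ∀ {m n} → m ℕ.≤′ n → s n ≤ s m + gap m
      go {m} {n} m≤n = ≤-trans (≤-difference (gap n) (0≤gap n) refl) (antitone m≤n)

    a≤s : ∀ n → a ≤ s n
    a≤s n = s-mono {0} {n} ℕ.z≤n

    -- From N on, all terms lie between `s N` and `s N + gap N`.
    s-cauchy : IsCauchy s
    s-cauchy ε 0<ε =
      let N , gap<ε = ½^-vanishes (D + 1ℚ) ε 0<ε
      in N , λ m n N≤m N≤n → ≤-<-trans
           (∣p-q∣≤width (s-mono N≤m) (s≤s+gap N≤m) (s-mono N≤n) (s≤s+gap N≤n))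
           (subst (_< ε) (solve 2 (λ s d → d := s :+ d :- s) refl (s N) (gap N)) (gap<ε N ℕ.≤-refl))
      where open +-*-Solver

    √D : ℝ
    √D = mkℝ s s-cauchy

    -- D lies between s² and (s + gap)², which differ by at most gap · 2(s + gap). The upper ends
    -- decrease, so twice the first one, `B`, bounds the second factor.
    √D*√D≃D : √D *ᴿ √D ≃ᴿ fromℚ D
    √D*√D≃D ε 0<ε =
      let N , small = ½^-vanishes ((D + 1ℚ) * B) ε 0<ε
      in N , λ n N≤n → ≤-<-trans (error n) (small n N≤n)
      where
      open +-*-Solver
      B = (a + (D + 1ℚ)) + (a + (D + 1ℚ))
      bound : ∀ n → s n + gap n ≤ a + (D + 1ℚ)
      bound zero    = ≤-reflexive (cong (λ t → a + t) (*-identityˡ (D + 1ℚ)))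
      bound (suc n) = ≤-trans (s+gap-decreasing n) (bound n)
      error : ∀ n → ∣ s n * s n - D ∣ ≤ ½ ^ n * ((D + 1ℚ) * B)
      error n = begin
        ∣ s n * s n - D ∣
          ≤⟨ ∣p-q∣≤width ≤-refl (≤-trans (s²≤D n) (D≤[s+gap]² n)) (s²≤D n) (D≤[s+gap]² n) ⟩
        (s n + gap n) * (s n + gap n) - s n * s n
          ≤⟨ ≤-difference (gap n * gap n) (0≤-* (0≤gap n) (0≤gap n))
               (solve 2 (λ s d → ((s :+ d) :* (s :+ d) :- s :* s) :+ d :* d := d :* ((s :+ d) :+ (s :+ d))) refl (s n) (gap n)) ⟩
        gap n * ((s n + gap n) + (s n + gap n))
          ≤⟨ *-monoˡ-≤-nonNeg (gap n) {{nonNegative (0≤gap n)}} (+-mono-≤ (bound n) (bound n)) ⟩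
        gap n * B
          ≡⟨ *-assoc (½ ^ n) (D + 1ℚ) B ⟩
        ½ ^ n * ((D + 1ℚ) * B) ∎
        where open ≤-Reasoning

    √D-isSqrt : IsSqrt √D (fromℚ D)
    √D-isSqrt = (λ ε 0<ε → 0 , λ n _ → 0≤-+ (≤-trans 0≤a (a≤s n)) (<⇒≤ 0<ε)) , √D*√D≃D

-- Termwise evaluation of real determinants, and the Seidel matrix of the hyperstar as a quotient
-- matrix.

module SeidelMatrix where
  open Determinant
  open QuotientMatrix
  open import Data.Integer.Base using (+_)
  open import Data.Rational.Base using (_+_; _*_; _-_; -_)
  open RawSemiringDefs (RawRing.rawSemiring ℚ.+-*-rawRing) using (_^_; sum; product)
  open RawRing ℝ-rawRing using (rawSemiring; 1#)
  open RawSemiringDefs rawSemiring using () renaming (_^_ to _^ᴿ_)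

  seq-∑ : ∀ {n} {f : Fin n → ℝ} {g : Fin n → ℚ} {t} → (∀ i → seq (f i) t ≡ g i) → seq (∑ f) t ≡ sum g
  seq-∑ {zero}  f≡g = refl
  seq-∑ {suc n} f≡g = cong₂ _+_ (f≡g zero) (seq-∑ (f≡g ∘ suc))

  seq-∏ : ∀ {n} {f : Fin n → ℝ} {g : Fin n → ℚ} {t} → (∀ i → seq (f i) t ≡ g i) → seq (∏ f) t ≡ product g
  seq-∏ {zero}  f≡g = refl
  seq-∏ {suc n} f≡g = cong₂ _*_ (f≡g zero) (seq-∏ (f≡g ∘ suc))

  seq-^ : ∀ x k t → seq (x ^ᴿ k) t ≡ seq x t ^ k
  seq-^ x zero    t = refl
  seq-^ x (suc k) t = cong (seq x t *_) (seq-^ x k t)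

  -- The tail g is left implicit so that it is read off the sum in det: comparing
  -- two spellings of a summand as reals would unfold their Cauchy proofs.
  seq-∑-cons : ∀ {n} a {g : Fin n → ℝ} {b : ℚ} {h : Fin n → ℚ} {t} →
    seq a t ≡ b → (∀ i → seq (g i) t ≡ h i) → seq (a +ᴿ ∑ g) t ≡ b + sum h
  seq-∑-cons a a≡b g≡h = cong₂ _+_ a≡b (seq-∑ g≡h)

  laplaceTerm : ∀ {n} → Matrix ℝ (suc n) → Fin (suc n) → ℝ
  laplaceTerm M j = ((-ᴿ 1#) ^ᴿ toℕ j) *ᴿ (M zero j *ᴿ det (λ r c → M (suc r) (punchIn j c)))

  seq-laplaceTerm : ∀ {n} (M : Matrix ℝ (suc n)) j t {d} → seq (det (λ r c → M (suc r) (punchIn j c))) t ≡ d →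
    seq (laplaceTerm M j) t ≡ sign j * (seq (M zero j) t * d)
  seq-laplaceTerm M j t eq = cong₂ (λ s d → s * (seq (M zero j) t * d)) (seq-^ (-ᴿ 1#) (toℕ j) t) eq

  seq-det : ∀ {n} (M : Matrix ℝ n) t → seq (det M) t ≡ detℚ (λ i j → seq (M i j) t)
  seq-det {zero}  M t = refl
  seq-det {suc n} M t = seq-∑-cons (laplaceTerm M zero)
    (seq-laplaceTerm M zero t (seq-det (λ r c → M (suc r) (punchIn zero c)) t))
    (λ j → seq-laplaceTerm M (suc j) t (seq-det (λ r c → M (suc r) (punchIn (suc j) c)) t))

  seq-I : ∀ {n} (i j : Fin n) t → seq (I i j) t ≡ δ i j
  seq-I i j t = seq-if (does (i ≟ j))
    where
    seq-if : ∀ b → seq (if b then fromℤ (+ 1) else fromℤ (+ 0)) t ≡ (if b then 1ℚ else 0ℚ)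
    seq-if true  = refl
    seq-if false = refl

  -- The diagonal of S is zero; splitting x as (x - 1) + 1 gives a vertex coupling 1 with itself,
  -- the same as with the other vertices of its label.
  diagonal-entry : ∀ x {d a k} → d ≡ 1ℚ → a ≡ 0 → k ≡ 1ℚ →
    x * d - ((1ℚ - d) - ι (+ 2) * ι (+ a)) ≡ (x - 1ℚ) * d + 1ℚ * k
  diagonal-entry x refl refl refl = solve 1 (λ x →
    x :* con 1ℚ :- ((con 1ℚ :- con 1ℚ) :- con (ι (+ 2)) :* con (ι (+ 0)))
      := (x :- con 1ℚ) :* con 1ℚ :+ con 1ℚ :* con 1ℚ) refl x
    where open +-*-Solver

  off-diagonal-entry : ∀ x {d a k} b → d ≡ 0ℚ → a ≡ b → k ≡ ι (+ 2) * ι (+ b) - 1ℚ →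
    x * d - ((1ℚ - d) - ι (+ 2) * ι (+ a)) ≡ (x - 1ℚ) * d + 1ℚ * k
  off-diagonal-entry x b refl refl refl = solve 2 (λ x k →
    x :* con 0ℚ :- ((con 1ℚ :- con 0ℚ) :- con (ι (+ 2)) :* k)
      := (x :- con 1ℚ) :* con 0ℚ :+ con 1ℚ :* (con (ι (+ 2)) :* k :- con 1ℚ)) refl x (ι (+ b))
    where open +-*-Solver

  module _ {A : Set} {P : A → Set} (P? : Decidable P) where
    length-filter-none : ∀ {n} (f : Fin n → A) → (∀ i → ¬ P (f i)) → length (filter P? (tabulate f)) ≡ 0
    length-filter-none f none = cong length (filter-none P? (All.tabulate⁺ none))

    length-filter-one : ∀ {n} (f : Fin n → A) i → P (f i) → (∀ j → P (f j) → j ≡ i) →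
      length (filter P? (tabulate f)) ≡ 1
    length-filter-one f zero    Pi unique = trans (cong length (filter-accept P? Pi))
      (cong suc (length-filter-none (f ∘ suc) λ j Pj → case unique (suc j) Pj of λ ()))
    length-filter-one f (suc i) Pi unique = trans
      (cong length (filter-reject P? λ P0 → case unique zero P0 of λ ()))
      (length-filter-one (f ∘ suc) i Pi λ j Pj → suc-injective (unique (suc j) Pj))

  -- Here `m` is the number n - 1 of edges, `q` is k - 2, and `p` counts the non-central vertices of
  -- an edge.
  module _ (m q : ℕ) (2≤k : 2 ℕ.≤ suc (suc q)) where
    private
      p = suc q
      G = hyperstar (suc m) (suc p) 2≤k

    label : Fin (suc (m ℕ.* p)) → Maybe (Fin m)
    label zero    = nothing
    label (suc v) = just (quotient p v)

    Meets : Fin m → Maybe (Fin m) → Set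
    Meets a nothing  = ⊤
    Meets a (just b) = b ≡ a

    ∈-edge⁻ : ∀ a u → u ∈ hyperstarEdge (suc m) (suc p) a → Meets a (label u)
    ∈-edge⁻ a zero    _         = _
    ∈-edge⁻ a (suc v) (there h) = witness (quotient p v ≟ a)
      (trans (sym (lookup∘tabulate (λ v → does (quotient p v ≟ a)) v)) ([]=⇒lookup h))
      where
      witness : ∀ {A : Set} (d : Dec A) → does d ≡ true → A
      witness (yes x) _ = x

    ∈-edge⁺ : ∀ a u → Meets a (label u) → u ∈ hyperstarEdge (suc m) (suc p) a
    ∈-edge⁺ a zero    _    = here
    ∈-edge⁺ a (suc v) refl = there (lookup⇒[]= v _
      (trans (lookup∘tabulate (λ v → does (quotient p v ≟ a)) v) (dec-true (quotient p v ≟ a) refl)))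

    ⊆-edge⁻ : ∀ a u v → ⁅ u ⁆ ∪ ⁅ v ⁆ ⊆ hyperstarEdge (suc m) (suc p) a →
      Meets a (label u) × Meets a (label v)
    ⊆-edge⁻ a u v uv⊆e =
        ∈-edge⁻ a u (uv⊆e (x∈p∪q⁺ (inj₁ (x∈⁅x⁆ u))))
      , ∈-edge⁻ a v (uv⊆e (x∈p∪q⁺ (inj₂ (x∈⁅x⁆ v))))

    ⊆-edge⁺ : ∀ a u v → Meets a (label u) → Meets a (label v) →
      ⁅ u ⁆ ∪ ⁅ v ⁆ ⊆ hyperstarEdge (suc m) (suc p) a
    ⊆-edge⁺ a u v mu mv w∈ with x∈p∪q⁻ ⁅ u ⁆ ⁅ v ⁆ w∈
    ... | inj₁ w∈u rewrite x∈⁅y⁆⇒x≡y u w∈u = ∈-edge⁺ a u mu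
    ... | inj₂ w∈v rewrite x∈⁅y⁆⇒x≡y v w∈v = ∈-edge⁺ a v mv

    -- The entry of -S (up to the diagonal) for vertices of given labels.
    coupling : Maybe (Fin m) → Maybe (Fin m) → ℚ
    coupling (just a) (just b) = if does (a ≟ b) then 1ℚ else - 1ℚ
    coupling _        _        = 1ℚ

    coupling-refl : ∀ b → coupling b b ≡ 1ℚ
    coupling-refl nothing  = refl
    coupling-refl (just a) rewrite dec-true (a ≟ a) refl = refl

    commonEdges : Fin (suc (m ℕ.* p)) → Fin (suc (m ℕ.* p)) → ℕ
    commonEdges u v = length (filter (⁅ u ⁆ ∪ ⁅ v ⁆ ⊆?_) (edges G))

    commonEdges-one : ∀ a u v → Meets a (label u) → Meets a (label v) →
      (∀ b → Meets b (label u) → Meets b (label v) → b ≡ a) → commonEdges u v ≡ 1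
    commonEdges-one a u v mu mv unique = length-filter-one (⁅ u ⁆ ∪ ⁅ v ⁆ ⊆?_) (hyperstarEdge (suc m) (suc p)) a
      (⊆-edge⁺ a u v mu mv) λ b ⊆e → unique b (proj₁ (⊆-edge⁻ b u v ⊆e)) (proj₂ (⊆-edge⁻ b u v ⊆e))

    -- A non-central vertex lies in exactly one edge and the centre in all. So distinct vertices
    -- share one edge, or none if both are non-central with different labels; 2a - 1 is then 1 or
    -- -1.
    coupling-commonEdges : ∀ u v → u ≢ v →
      coupling (label u) (label v) ≡ ι (+ 2) * ι (+ commonEdges u v) - 1ℚ
    coupling-commonEdges zero    zero    u≢v = contradiction refl u≢v
    coupling-commonEdges zero    (suc v) _ =
      cong (λ k → ι (+ 2) * ι (+ k) - 1ℚ) (sym (commonEdges-one (quotient p v) zero (suc v) _ refl λ b _ → sym))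
    coupling-commonEdges (suc u) zero    _ =
      cong (λ k → ι (+ 2) * ι (+ k) - 1ℚ) (sym (commonEdges-one (quotient p u) (suc u) zero refl _ λ b eq _ → sym eq))
    coupling-commonEdges (suc u) (suc v) _ = by-cases (quotient p u ≟ quotient p v)
      where
      by-cases : (d : Dec (quotient p u ≡ quotient p v)) →
        (if does d then 1ℚ else - 1ℚ) ≡ ι (+ 2) * ι (+ commonEdges (suc u) (suc v)) - 1ℚ
      by-cases (yes eq) = cong (λ k → ι (+ 2) * ι (+ k) - 1ℚ)
        (sym (commonEdges-one (quotient p u) (suc u) (suc v) refl (sym eq) λ b eq _ → sym eq))
      by-cases (no neq) = cong (λ k → ι (+ 2) * ι (+ k) - 1ℚ)
        (sym (length-filter-none (⁅ suc u ⁆ ∪ ⁅ suc v ⁆ ⊆?_) (hyperstarEdge (suc m) (suc p)) λ b ⊆e →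
          neq (trans (proj₁ (⊆-edge⁻ b (suc u) (suc v) ⊆e)) (sym (proj₂ (⊆-edge⁻ b (suc u) (suc v) ⊆e))))))

    seq-xI-S : ∀ x t u v → seq (x *ᴿ I u v -ᴿ seidel G u v) t
      ≡ Quotient.K coupling (seq x t - 1ℚ) (λ u → label u , 1ℚ) u v
    seq-xI-S x t u v = trans
      (cong (λ d → seq x t * d - ((1ℚ - d) - ι (+ 2) * ι (+ adjacency G u v))) (seq-I u v t))
      (by-cases (u ≟ v))
      where
      by-cases : Dec (u ≡ v) → seq x t * δ u v - ((1ℚ - δ u v) - ι (+ 2) * ι (+ adjacency G u v))
        ≡ (seq x t - 1ℚ) * δ u v + 1ℚ * coupling (label u) (label v)
      by-cases (yes refl) = diagonal-entry (seq x t) (δ-refl u)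
        (cong (λ b → if b then 0 else commonEdges u u) (dec-true (u ≟ u) refl)) (coupling-refl (label u))
      by-cases (no u≢v) = off-diagonal-entry (seq x t) (commonEdges u v) (δ-≢ u≢v)
        (cong (λ b → if b then 0 else commonEdges u v) (dec-false (u ≟ v) u≢v)) (coupling-commonEdges u v u≢v)

-- Sums and products over repeated blocks, and the characteristic polynomial.

module CharacteristicPolynomial where
  open Determinant
  open QuotientMatrix
  open SeidelMatrix
  open import Data.Integer.Base using (+_)
  open import Data.Rational.Base using (_+_; _*_; _-_; -_)
  open RawSemiringDefs (RawRing.rawSemiring ℚ.+-*-rawRing) using (_^_; sum; product)
  open ≡-Reasoning

  -- General in `F`, since the same vector of eigenvalues is used with z ↦ x - z for the polynomial
  -- and with the absolute value for the energy.
  module _ {a} {A : Set a} (F : A → ℚ) where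
    sum-lookup-++ : ∀ {m n} (xs : Vec A m) (ys : Vec A n) →
      sum (F ∘ Vec.lookup (xs Vec.++ ys)) ≡ sum (F ∘ Vec.lookup xs) + sum (F ∘ Vec.lookup ys)
    sum-lookup-++ []       ys = sym (ℚ.+-identityˡ (sum (F ∘ Vec.lookup ys)))
    sum-lookup-++ (x ∷ xs) ys = trans (cong (λ s → F x + s) (sum-lookup-++ xs ys))
      (sym (ℚ.+-assoc (F x) (sum (F ∘ Vec.lookup xs)) (sum (F ∘ Vec.lookup ys))))

    sum-lookup-replicate : ∀ n x → sum (F ∘ Vec.lookup (Vec.replicate n x)) ≡ ι (+ n) * F x
    sum-lookup-replicate zero    x = sym (ℚ.*-zeroˡ (F x))
    sum-lookup-replicate (suc n) x = trans (cong (λ s → F x + s) (sum-lookup-replicate n x)) (ι-suc-* n (F x))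
      where
      ι-suc-* : ∀ n y → y + ι (+ n) * y ≡ ι (+ suc n) * y
      ι-suc-* n y = trans (solve 2 (λ k y → y :+ k :* y := (con 1ℚ :+ k) :* y) refl (ι (+ n)) y)
        (cong (_* y) (sym (ι-+ (+ 1) (+ n))))
        where open +-*-Solver

    sum-lookup-concat-replicate : ∀ {k} n (xs : Vec A k) →
      sum (F ∘ Vec.lookup (Vec.concat (Vec.replicate n xs))) ≡ ι (+ n) * sum (F ∘ Vec.lookup xs)
    sum-lookup-concat-replicate zero    xs = sym (ℚ.*-zeroˡ (sum (F ∘ Vec.lookup xs)))
    sum-lookup-concat-replicate (suc n) xs = begin
      sum (F ∘ Vec.lookup (xs Vec.++ Vec.concat (Vec.replicate n xs)))
        ≡⟨ sum-lookup-++ xs (Vec.concat (Vec.replicate n xs)) ⟩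
      S + sum (F ∘ Vec.lookup (Vec.concat (Vec.replicate n xs)))
        ≡⟨ cong (λ s → S + s) (sum-lookup-concat-replicate n xs) ⟩
      S + ι (+ n) * S
        ≡⟨ solve 2 (λ k y → y :+ k :* y := (con 1ℚ :+ k) :* y) refl (ι (+ n)) S ⟩
      (1ℚ + ι (+ n)) * S
        ≡⟨ cong (_* S) (ι-+ (+ 1) (+ n)) ⟨
      ι (+ suc n) * S ∎
      where
      open +-*-Solver
      S = sum (F ∘ Vec.lookup xs)

    product-lookup-++ : ∀ {m n} (xs : Vec A m) (ys : Vec A n) →
      product (F ∘ Vec.lookup (xs Vec.++ ys)) ≡ product (F ∘ Vec.lookup xs) * product (F ∘ Vec.lookup ys)
    product-lookup-++ []       ys = sym (ℚ.*-identityˡ (product (F ∘ Vec.lookup ys)))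
    product-lookup-++ (x ∷ xs) ys = trans (cong (F x *_) (product-lookup-++ xs ys))
      (sym (ℚ.*-assoc (F x) (product (F ∘ Vec.lookup xs)) (product (F ∘ Vec.lookup ys))))

    product-lookup-replicate : ∀ n x → product (F ∘ Vec.lookup (Vec.replicate n x)) ≡ F x ^ n
    product-lookup-replicate zero    x = refl
    product-lookup-replicate (suc n) x = cong (F x *_) (product-lookup-replicate n x)

    product-lookup-concat-replicate : ∀ {k} n (xs : Vec A k) →
      product (F ∘ Vec.lookup (Vec.concat (Vec.replicate n xs))) ≡ product (F ∘ Vec.lookup xs) ^ n
    product-lookup-concat-replicate zero    xs = refl
    product-lookup-concat-replicate (suc n) xs = trans
      (product-lookup-++ xs (Vec.concat (Vec.replicate n xs)))
      (cong (product (F ∘ Vec.lookup xs) *_) (product-lookup-concat-replicate n xs))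

  ^-distrib-* : ∀ x y n → (x * y) ^ n ≡ x ^ n * y ^ n
  ^-distrib-* x y n = CommutativeMonoidMult.×-distrib-+ ℚ.*-1-commutativeMonoid x y n

  module CharPoly (m q : ℕ) (2≤k : 2 ℕ.≤ suc (suc q)) where
    -- From here on n = m + 2. `P` = k - 1 is the weight of a merged edge and `W` = (n-1)(k-1) that
    -- of all leaves together, written in the shape that `detK-replicate` produces.
    P W λ₂ : ℚ
    P = ι (+ suc q)
    W = P + ι (+ m) * P
    λ₂ = 1ℚ - (P + P)

    private
      c = coupling (suc m) q 2≤k

    -- After the merges each edge is a single vertex of weight P. Moving 2P from the
    -- coupling of an edge with itself to the diagonal makes all these vertices alike.
    data Kind : Set where
      center leaf : Kind

    -- The shift of the diagonal also hits the centre, whose self-coupling becomes `λ₂` so that its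
    -- entry is still x. For a leaf, (x - 1) + P = (x - λ₂) - P.
    c′ : Kind → Kind → ℚ
    c′ center center = λ₂
    c′ leaf   leaf   = - 1ℚ
    c′ _      _      = 1ℚ

    blocks : Fin (suc (suc m)) → Maybe (Fin (suc m)) × ℚ
    blocks zero    = nothing , 1ℚ
    blocks (suc i) = just i , P

    leaves : Fin (suc (suc m)) → Kind × ℚ
    leaves zero    = center , 1ℚ
    leaves (suc i) = leaf , P

    recouple : ∀ x i j → Quotient.K c (x - 1ℚ) blocks i j ≡ Quotient.K c′ (x - λ₂) leaves i j
    recouple x zero    zero    = solve 2 (λ x p →
        (x :- con 1ℚ) :* con 1ℚ :+ con 1ℚ :* con 1ℚ :=
        (x :- (con 1ℚ :- (p :+ p))) :* con 1ℚ :+ con 1ℚ :* (con 1ℚ :- (p :+ p))) refl x P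
      where open +-*-Solver
    recouple x zero    (suc j) = solve 2 (λ x p →
        (x :- con 1ℚ) :* con 0ℚ :+ p :* con 1ℚ :=
        (x :- (con 1ℚ :- (p :+ p))) :* con 0ℚ :+ p :* con 1ℚ) refl x P
      where open +-*-Solver
    recouple x (suc i) zero    = solve 2 (λ x p →
        (x :- con 1ℚ) :* con 0ℚ :+ con 1ℚ :* con 1ℚ :=
        (x :- (con 1ℚ :- (p :+ p))) :* con 0ℚ :+ con 1ℚ :* con 1ℚ) refl x P
      where open +-*-Solver
    recouple x (suc i) (suc j) = by-cases (i ≟ j)
      where
      open +-*-Solver
      equal : ∀ {d k} → d ≡ 1ℚ → k ≡ 1ℚ →
        (x - 1ℚ) * d + P * k ≡ (x - λ₂) * d + P * - 1ℚ
      equal refl refl = solve 2 (λ x p →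
        (x :- con 1ℚ) :* con 1ℚ :+ p :* con 1ℚ :=
        (x :- (con 1ℚ :- (p :+ p))) :* con 1ℚ :+ p :* con (- 1ℚ)) refl x P
      distinct : ∀ {d k} → d ≡ 0ℚ → k ≡ - 1ℚ →
        (x - 1ℚ) * d + P * k ≡ (x - λ₂) * d + P * - 1ℚ
      distinct refl refl = solve 2 (λ x p →
        (x :- con 1ℚ) :* con 0ℚ :+ p :* con (- 1ℚ) :=
        (x :- (con 1ℚ :- (p :+ p))) :* con 0ℚ :+ p :* con (- 1ℚ)) refl x P
      by-cases : Dec (i ≡ j) →
        (x - 1ℚ) * δ (suc i) (suc j) + P * c (just i) (just j) ≡ (x - λ₂) * δ (suc i) (suc j) + P * - 1ℚ
      by-cases (yes i≡j) = equal (cong (λ b → if b then 1ℚ else 0ℚ) (dec-true (i ≟ j) i≡j))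
        (cong (λ b → if b then 1ℚ else - 1ℚ) (dec-true (i ≟ j) i≡j))
      by-cases (no i≢j) = distinct (cong (λ b → if b then 1ℚ else 0ℚ) (dec-false (i ≟ j) i≢j))
        (cong (λ b → if b then 1ℚ else - 1ℚ) (dec-false (i ≟ j) i≢j))

    -- The rows of the matrix are (x, w) and (1, x - λ₂ - w). The left polynomial spells out the
    -- unfolded determinant, trailing zeros included, because it has to match definitionally.
    det-center-leaf : ∀ x w → Quotient.detK c′ (x - λ₂) ((center , 1ℚ) ∷ (leaf , w) ∷ []) ≡ x * (x - λ₂ - w) - w
    det-center-leaf x w = solve 3 (λ x p w →
        con 1ℚ :* ((((x :- l p) :* con 1ℚ) :+ con 1ℚ :* l p) :*
          (con 1ℚ :* (((x :- l p) :* con 1ℚ :+ w :* con (- 1ℚ)) :* con 1ℚ) :+ con 0ℚ)) :+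
        (con (- 1ℚ) :* con 1ℚ :* (((x :- l p) :* con 0ℚ :+ w :* con 1ℚ) :*
          (con 1ℚ :* (((x :- l p) :* con 0ℚ :+ con 1ℚ :* con 1ℚ) :* con 1ℚ) :+ con 0ℚ)) :+ con 0ℚ)
        := x :* (x :- l p :- w) :- w) refl x P w
      where
      open +-*-Solver
      l : ∀ {n} → Polynomial n → Polynomial n
      l p = con 1ℚ :- (p :+ p)

    charPoly : ∀ x → detℚ (Quotient.K c (x - 1ℚ) (λ u → label (suc m) q 2≤k u , 1ℚ)) ≡
      ((x - 1ℚ) ^ q) ^ suc m * ((x - λ₂) ^ m * (x * (x - λ₂ - W) - W))
    charPoly x = begin
      detℚ (Q.K (λ u → label (suc m) q 2≤k u , 1ℚ))
        ≡⟨ Q.detK-tabulate (λ u → label (suc m) q 2≤k u , 1ℚ) ⟨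
      Q.detK ((nothing , 1ℚ) ∷ tabulate (λ v → just (quotient {suc m} (suc q) v) , 1ℚ))
        ≡⟨ Q.detK-blocks ((nothing , 1ℚ) ∷ []) (suc m) q just ⟩
      Y * Q.detK (tabulate blocks)
        -- The same matrix is reread with diagonal part x - λ₂, which makes the leaves mergeable.
        ≡⟨ cong (Y *_) (trans (Q.detK-tabulate blocks)
             (trans (detℚ-cong (recouple x)) (sym (R.detK-tabulate leaves)))) ⟩
      Y * R.detK (tabulate leaves)
        ≡⟨ cong (λ r → Y * R.detK ((center , 1ℚ) ∷ (leaf , P) ∷ r))
             (trans (tabulate-const m (leaf , P)) (sym (++-identityʳ (replicate m (leaf , P))))) ⟩
      Y * R.detK ((center , 1ℚ) ∷ (leaf , P) ∷ replicate m (leaf , P) ++ [])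
        ≡⟨ cong (Y *_) (R.detK-replicate ((center , 1ℚ) ∷ []) leaf P P m []) ⟩
      Y * ((x - λ₂) ^ m * R.detK ((center , 1ℚ) ∷ (leaf , W) ∷ []))
        ≡⟨ cong (λ d → Y * ((x - λ₂) ^ m * d)) (det-center-leaf x W) ⟩
      Y * ((x - λ₂) ^ m * (x * (x - λ₂ - W) - W)) ∎
      where
      module Q = Quotient c (x - 1ℚ)
      module R = Quotient c′ (x - λ₂)
      Y = ((x - 1ℚ) ^ q) ^ suc m

-- The spectrum, the energy and the closed formulas.

module SeidelEnergy where
  open Determinant
  open QuotientMatrix
  open SquareRoot
  open SeidelMatrix
  open CharacteristicPolynomial
  open import Data.Integer.Base using (+_)
  open import Data.Rational.Base using (_+_; _*_; _-_; -_; ∣_∣; _≤_; _<_)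
  open import Data.Rational.Properties using (≤-trans; ≤-reflexive; 0≤∣p∣; 0≤p⇒∣p∣≡p; ∣-p∣≡∣p∣; ∣p∣≡p∨∣p∣≡-p)
  open RawSemiringDefs (RawRing.rawSemiring ℚ.+-*-rawRing) using (_^_; sum; product)
  open RawRing ℝ-rawRing using (rawSemiring)
  open RawSemiringDefs rawSemiring using () renaming (_^_ to _^ᴿ_)
  open ≡-Reasoning

  ≃ᴿ-pointwise : ∀ x y → (∀ t → seq x t ≡ seq y t) → x ≃ᴿ y
  ≃ᴿ-pointwise x y eq ε 0<ε = 0 , λ t _ →
    subst (_< ε) (sym (cong ∣_∣ (trans (cong (λ p → p - seq y t) (eq t)) (ℚ.+-inverseʳ (seq y t))))) 0<ε

  -- Equivalence depends only on termwise differences, so one known limit can be carried over to any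
  -- pair with the same differences.
  ≃ᴿ-difference : ∀ x y u v → (∀ t → seq x t - seq y t ≡ seq u t - seq v t) → u ≃ᴿ v → x ≃ᴿ y
  ≃ᴿ-difference x y u v eq u≃v ε 0<ε =
    let N , h = u≃v ε 0<ε
    in N , λ t N≤t → subst (λ d → ∣ d ∣ < ε) (sym (eq t)) (h t N≤t)

  *ᴿ-congˡ : ∀ z x y → x ≃ᴿ y → z *ᴿ x ≃ᴿ z *ᴿ y
  *ᴿ-congˡ z x y x≃y ε 0<ε =
    let B , B>0 , K , z≤B = CauchyLemmas.bounded (cauchy z)
        C , C>0 , L , y≤C = CauchyLemmas.bounded (cauchy y)
        d , 0<d , sum≡ε   = ProductLemmas.split B C B>0 C>0 0<ε
        M , close         = x≃y d 0<d
    in (K ℕ.⊔ L) ℕ.⊔ M , λ t N≤t →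
         let KL≤t = ℕ.m⊔n≤o⇒m≤o (K ℕ.⊔ L) M N≤t
         in ProductLemmas.*-close (seq z t) (seq x t) (seq z t) (seq y t) B>0 C>0 sum≡ε
              (z≤B t (ℕ.m⊔n≤o⇒m≤o K L KL≤t)) (y≤C t (ℕ.m⊔n≤o⇒n≤o K L KL≤t))
              (close t (ℕ.m⊔n≤o⇒n≤o (K ℕ.⊔ L) M N≤t))
              (subst (_< d) (sym (cong ∣_∣ (ℚ.+-inverseʳ (seq z t)))) 0<d)

  -- The determinant and the product need not agree at any index; it is enough that their error is,
  -- term by term, that of a known equivalence.
  isSpectrum-pointwise : ∀ {n} (S : Matrix ℝ n) (ev : Fin n → ℝ) (u v : ℝ → ℝ) → (∀ x → u x ≃ᴿ v x) →
    (∀ x t → detℚ (λ i j → seq (x *ᴿ I i j -ᴿ S i j) t) - product (λ i → seq x t - seq (ev i) t)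
      ≡ seq (u x) t - seq (v x) t) → IsSpectrum S ev
  isSpectrum-pointwise S ev u v u≃v eq x = ≃ᴿ-difference
    (det λ i j → x *ᴿ I i j -ᴿ S i j) (∏ λ i → x -ᴿ ev i) (u x) (v x)
    (λ t → trans
      (cong₂ _-_ (seq-det (λ i j → x *ᴿ I i j -ᴿ S i j) t) (seq-∏ {f = λ i → x -ᴿ ev i} {t = t} (λ i → refl)))
      (eq x t))
    (u≃v x)

  0≤∣p∣+p : ∀ p → 0ℚ ≤ ∣ p ∣ + p
  0≤∣p∣+p p with ∣p∣≡p∨∣p∣≡-p p
  ... | inj₁ eq = subst (λ r → 0ℚ ≤ ∣ p ∣ + r) eq (0≤-+ (0≤∣p∣ p) (0≤∣p∣ p))
  ... | inj₂ eq = ≤-reflexive (sym (trans (cong (_+ p) eq) (ℚ.+-inverseˡ p)))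

  ∣p∣*∣p∣≡p*p : ∀ p → ∣ p ∣ * ∣ p ∣ ≡ p * p
  ∣p∣*∣p∣≡p*p p with ∣p∣≡p∨∣p∣≡-p p
  ... | inj₁ eq = cong₂ _*_ eq eq
  ... | inj₂ eq = trans (cong₂ _*_ eq eq) (solve 1 (λ p → (:- p) :* (:- p) := p :* p) refl p)
    where open +-*-Solver

  infix  4 _↦_
  infixl 6 _⊕_ _⊖_
  infixl 7 _⊛_

  -- Derivations built with `_⊕_`, `_⊖_` and `_⊛_` follow an integer formula and yield its image in
  -- ℚ. As a record it exposes `i` and `p` to unification, which a bare equation would hide under
  -- `ι`.
  record _↦_ (i : ℤ) (p : ℚ) : Set where
    constructor ↦[_]
    field image : ι i ≡ p

  open _↦_

  _⊕_ : ∀ {i j x y} → i ↦ x → j ↦ y → i ℤ.+ j ↦ x + y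
  _⊕_ {i} {j} ↦[ p ] ↦[ r ] = ↦[ trans (ι-+ i j) (cong₂ _+_ p r) ]

  _⊖_ : ∀ {i j x y} → i ↦ x → j ↦ y → i ℤ.- j ↦ x - y
  _⊖_ {i} {j} ↦[ p ] ↦[ r ] = ↦[ trans (ι-+ i (ℤ.- j)) (cong₂ _+_ p (trans (ι-neg j) (cong -_ r))) ]

  _⊛_ : ∀ {i j x y} → i ↦ x → j ↦ y → i ℤ.* j ↦ x * y
  _⊛_ {i} {j} ↦[ p ] ↦[ r ] = ↦[ trans (ι-* i j) (cong₂ _*_ p r) ]

  numeral : ∀ i → i ↦ ι i
  numeral i = ↦[ refl ]

  natural : ∀ i j → + (i ℕ.+ j) ↦ ι (+ i) + ι (+ j)
  natural i j = ↦[ ι-+ (+ i) (+ j) ]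

  module Hyperstar (m q : ℕ) (2≤k : 2 ℕ.≤ suc (suc q)) where
    open CharPoly m q 2≤k

    -- `D` is the discriminant b² + 4W of x(x - λ₂ - W) - W = x² - bx - W.
    Q M b D : ℚ
    Q = ι (+ q)
    M = ι (+ m)
    b = W + λ₂
    D = b * b + (W + W + (W + W))

    P≡1+Q : P ≡ 1ℚ + Q
    P≡1+Q = ι-+ (+ 1) (+ q)

    0≤W : 0ℚ ≤ W
    0≤W = 0≤-+ (0≤ι (suc q)) (0≤-* (0≤ι m) (0≤ι (suc q)))

    ∣b∣²≤D : ∣ b ∣ * ∣ b ∣ ≤ D
    ∣b∣²≤D = ≤-difference (W + W + (W + W)) (0≤-+ (0≤-+ 0≤W 0≤W) (0≤-+ 0≤W 0≤W))
      (cong (_+ (W + W + (W + W))) (∣p∣*∣p∣≡p*p b))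

    -- Starting the bisection at ∣b∣ keeps every approximation s of √D above ∣b∣, so that
    -- the signs of (b ± s)/2 are known term by term.
    open Bisection ∣ b ∣ D (0≤∣p∣ b) ∣b∣²≤D using (s; a≤s; √D; √D*√D≃D; √D-isSqrt)

    r₊ r₋ : ℝ
    r₊ = fromℚ ½ *ᴿ (fromℚ b +ᴿ √D)
    r₋ = fromℚ ½ *ᴿ (fromℚ b -ᴿ √D)

    -- Arranged to fit the length 1 + (m+1)(q+1): after `r₊` come blocks of q + 1 entries, each a
    -- special eigenvalue followed by q ones.
    eigenvalues : Vec ℝ (suc (suc m ℕ.* suc q))
    eigenvalues = r₊ ∷ Vec.concat ((r₋ ∷ Vec.replicate q (fromℚ 1ℚ))
                     ∷ Vec.replicate m (fromℚ λ₂ ∷ Vec.replicate q (fromℚ 1ℚ)))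

    product-eigenvalues : ∀ (F : ℝ → ℚ) → product (F ∘ Vec.lookup eigenvalues) ≡
      F r₊ * ((F r₋ * F (fromℚ 1ℚ) ^ q) * (F (fromℚ λ₂) ^ m * (F (fromℚ 1ℚ) ^ q) ^ m))
    product-eigenvalues F = cong (F r₊ *_) (trans
      (product-lookup-++ F (r₋ ∷ Vec.replicate q (fromℚ 1ℚ)) (Vec.concat (Vec.replicate m block)))
      (cong₂ _*_ (cong (F r₋ *_) (product-lookup-replicate F q (fromℚ 1ℚ)))
        (trans (product-lookup-concat-replicate F m block)
          (trans (cong (_^ m) (cong (F (fromℚ λ₂) *_) (product-lookup-replicate F q (fromℚ 1ℚ))))
            (^-distrib-* (F (fromℚ λ₂)) (F (fromℚ 1ℚ) ^ q) m)))))
      where block = fromℚ λ₂ ∷ Vec.replicate q (fromℚ 1ℚ)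

    sum-eigenvalues : ∀ (F : ℝ → ℚ) → sum (F ∘ Vec.lookup eigenvalues) ≡
      F r₊ + ((F r₋ + Q * F (fromℚ 1ℚ)) + M * (F (fromℚ λ₂) + Q * F (fromℚ 1ℚ)))
    sum-eigenvalues F = cong (λ e → F r₊ + e) (trans
      (sum-lookup-++ F (r₋ ∷ Vec.replicate q (fromℚ 1ℚ)) (Vec.concat (Vec.replicate m block)))
      (cong₂ _+_ (cong (λ e → F r₋ + e) (sum-lookup-replicate F q (fromℚ 1ℚ)))
        (trans (sum-lookup-concat-replicate F m block)
          (cong (λ e → M * (F (fromℚ λ₂) + e)) (sum-lookup-replicate F q (fromℚ 1ℚ))))))
      where block = fromℚ λ₂ ∷ Vec.replicate q (fromℚ 1ℚ)

    ¼ : ℚ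
    ¼ = ½ * ½

    -- The product of x - (b ± s)/2 is x² - bx + (b² - s²)/4, and -W = (b² - D)/4. The defect is
    -- thus (s² - D)/4 times the common factors.
    quadratic-defect : ∀ x s w l Y Z V →
      Y * Z * (V * (x * (x - l - w) - w))
        - (x - ½ * (w + l + s)) * (((x - ½ * (w + l - s)) * Y) * (V * Z))
      ≡ Y * Z * V * ¼ * (s * s) - Y * Z * V * ¼ * ((w + l) * (w + l) + (w + w + (w + w)))
    quadratic-defect = solve 7 (λ x s w l Y Z V →
      Y :* Z :* (V :* (x :* (x :- l :- w) :- w))
        :- (x :- con ½ :* (w :+ l :+ s)) :* (((x :- con ½ :* (w :+ l :- s)) :* Y) :* (V :* Z))
      := Y :* Z :* V :* (con ½ :* con ½) :* (s :* s)
         :- Y :* Z :* V :* (con ½ :* con ½) :* ((w :+ l) :* (w :+ l) :+ (w :+ w :+ (w :+ w)))) refl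
      where open +-*-Solver

    isSpectrum : IsSpectrum (seidel (hyperstar (suc (suc m)) (suc (suc q)) 2≤k)) (Vec.lookup eigenvalues)
    isSpectrum = isSpectrum-pointwise (seidel (hyperstar (suc (suc m)) (suc (suc q)) 2≤k)) (Vec.lookup eigenvalues)
      (λ x → cofactor x *ᴿ (√D *ᴿ √D)) (λ x → cofactor x *ᴿ fromℚ D)
      (λ x → *ᴿ-congˡ (cofactor x) (√D *ᴿ √D) (fromℚ D) √D*√D≃D) difference
      where
      cofactor : ℝ → ℝ
      cofactor x = ((X₁ ^ᴿ q) *ᴿ ((X₁ ^ᴿ q) ^ᴿ m)) *ᴿ (X₂ ^ᴿ m) *ᴿ fromℚ ¼
        where
        X₁ = x -ᴿ fromℚ 1ℚ
        X₂ = x -ᴿ fromℚ λ₂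

      module _ (x : ℝ) (t : ℕ) where
        F : ℝ → ℚ
        F z = seq x t - seq z t

        Y Z V : ℚ
        Y = (seq x t - 1ℚ) ^ q
        Z = Y ^ m
        V = (seq x t - λ₂) ^ m

        cofactor-value : seq (cofactor x) t ≡ Y * Z * V * ¼
        cofactor-value = cong (_* ¼) (cong₂ _*_
          (cong₂ _*_ (seq-^ X₁ q t) (trans (seq-^ (X₁ ^ᴿ q) m t) (cong (_^ m) (seq-^ X₁ q t))))
          (seq-^ X₂ m t))
          where
          X₁ = x -ᴿ fromℚ 1ℚ
          X₂ = x -ᴿ fromℚ λ₂

        difference : detℚ (λ i j → seq (x *ᴿ I i j -ᴿ seidel (hyperstar (suc (suc m)) (suc (suc q)) 2≤k) i j) t)
            - product (λ i → seq x t - seq (Vec.lookup eigenvalues i) t)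
          ≡ seq (cofactor x) t * (s t * s t) - seq (cofactor x) t * D
        difference = trans
          (cong₂ _-_ (trans (detℚ-cong (seq-xI-S (suc m) q 2≤k x t)) (charPoly (seq x t))) (product-eigenvalues F))
          (trans (quadratic-defect (seq x t) (s t) W λ₂ Y Z V)
            (cong (λ c → c * (s t * s t) - c * D) (sym cofactor-value)))

    module _ (t : ℕ) where
      ∣r₊∣ : seq ∣ r₊ ∣ᴿ t ≡ ½ * (b + s t)
      ∣r₊∣ = 0≤p⇒∣p∣≡p (0≤-* (ℚ.<⇒≤ (ℚ.positive⁻¹ ½))
        (subst (0ℚ ≤_) (ℚ.+-comm (s t) b) (≤-trans (0≤∣p∣+p b) (ℚ.+-monoˡ-≤ b (a≤s t)))))

      ∣r₋∣ : seq ∣ r₋ ∣ᴿ t ≡ ½ * (s t - b)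
      ∣r₋∣ = begin
        ∣ ½ * (b - s t) ∣      ≡⟨ cong ∣_∣ (solve 2 (λ b s → con ½ :* (b :- s) := :- (con ½ :* (s :- b))) refl b (s t)) ⟩
        ∣ - (½ * (s t - b)) ∣  ≡⟨ ∣-p∣≡∣p∣ (½ * (s t - b)) ⟩
        ∣ ½ * (s t - b) ∣      ≡⟨ 0≤p⇒∣p∣≡p (0≤-* (ℚ.<⇒≤ (ℚ.positive⁻¹ ½))
          (≤-trans (subst (λ a → 0ℚ ≤ a - b) (∣-p∣≡∣p∣ b) (0≤∣p∣+p (- b))) (ℚ.+-monoˡ-≤ (- b) (a≤s t)))) ⟩
        ½ * (s t - b)          ∎
        where open +-*-Solver

    ∣λ₂∣ : ∣ λ₂ ∣ ≡ 1ℚ + (Q + Q)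
    ∣λ₂∣ = begin
      ∣ 1ℚ - (P + P) ∣       ≡⟨ cong (λ p → ∣ 1ℚ - (p + p) ∣) P≡1+Q ⟩
      ∣ 1ℚ - (1ℚ + Q + (1ℚ + Q)) ∣
        ≡⟨ cong ∣_∣ (solve 1 (λ q → con 1ℚ :- (con 1ℚ :+ q :+ (con 1ℚ :+ q)) := :- (con 1ℚ :+ (q :+ q))) refl Q) ⟩
      ∣ - (1ℚ + (Q + Q)) ∣   ≡⟨ ∣-p∣≡∣p∣ (1ℚ + (Q + Q)) ⟩
      ∣ 1ℚ + (Q + Q) ∣       ≡⟨ 0≤p⇒∣p∣≡p (0≤-+ (ℚ.<⇒≤ (ℚ.positive⁻¹ 1ℚ)) (0≤-+ (0≤ι q) (0≤ι q))) ⟩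
      1ℚ + (Q + Q)           ∎
      where open +-*-Solver

    -- The q ones beside `r₋`, and in each of the m other blocks |λ₂| = 1 + 2q together with q ones.
    E : ℚ
    E = Q + M * (1ℚ + (Q + Q) + Q)

    energy-value : fromℚ E +ᴿ √D ≃ᴿ ∑ (λ i → ∣ Vec.lookup eigenvalues i ∣ᴿ)
    energy-value = ≃ᴿ-pointwise (fromℚ E +ᴿ √D) (∑ λ i → ∣ Vec.lookup eigenvalues i ∣ᴿ) λ t → sym (begin
      seq (∑ (λ i → ∣ Vec.lookup eigenvalues i ∣ᴿ)) t
        ≡⟨ seq-∑ {f = λ i → ∣ Vec.lookup eigenvalues i ∣ᴿ} {t = t} (λ i → refl) ⟩
      sum (λ i → seq ∣ Vec.lookup eigenvalues i ∣ᴿ t)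
        ≡⟨ sum-eigenvalues (λ z → seq ∣ z ∣ᴿ t) ⟩
      seq ∣ r₊ ∣ᴿ t + ((seq ∣ r₋ ∣ᴿ t + Q * 1ℚ) + M * (∣ λ₂ ∣ + Q * 1ℚ))
        ≡⟨ cong₂ _+_ (∣r₊∣ t) (cong₂ (λ u v → (u + Q * 1ℚ) + M * (v + Q * 1ℚ)) (∣r₋∣ t) ∣λ₂∣) ⟩
      ½ * (b + s t) + ((½ * (s t - b) + Q * 1ℚ) + M * (1ℚ + (Q + Q) + Q * 1ℚ))
        -- The two halves of b cancel, so `r₊` and `r₋` contribute exactly `s t`.
        ≡⟨ collect b (s t) Q M ⟩
      E + s t ∎)
      where
      open +-*-Solver
      collect : ∀ b s q m → ½ * (b + s) + ((½ * (s - b) + q * 1ℚ) + m * (1ℚ + (q + q) + q * 1ℚ))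
        ≡ q + m * (1ℚ + (q + q) + q) + s
      collect = solve 4 (λ b s q m →
        con ½ :* (b :+ s) :+ ((con ½ :* (s :- b) :+ q :* con 1ℚ) :+ m :* (con 1ℚ :+ (q :+ q) :+ q :* con 1ℚ))
          := q :+ m :* (con 1ℚ :+ (q :+ q) :+ q) :+ s) refl

    D-formula : ι ((+ suc (suc q) ℤ.- + 1) ℤ.^ 2 ℤ.* (+ suc (suc m) ℤ.- + 3) ℤ.^ 2
                   ℤ.+ + 2 ℤ.* (+ suc (suc q) ℤ.- + 1) ℤ.* (+ 3 ℤ.* + suc (suc m) ℤ.- + 5) ℤ.+ + 1) ≡ D
    D-formula = trans
      -- The integer square unfolds to i * (i * 1), which accounts for the factors `numeral (+ 1)`.
      (image ((k-1 ⊛ (k-1 ⊛ numeral (+ 1))) ⊛ (n-3 ⊛ (n-3 ⊛ numeral (+ 1)))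
           ⊕ numeral (+ 2) ⊛ k-1 ⊛ (numeral (+ 3) ⊛ natural 2 m ⊖ numeral (+ 5)) ⊕ numeral (+ 1)))
      (trans
        (solve 2 (λ Q M →
           let K = con (ι (+ 2)) :+ Q :- con (ι (+ 1))
               N = con (ι (+ 2)) :+ M :- con (ι (+ 3))
               p = con 1ℚ :+ Q
               w = p :+ M :* p
               b = w :+ (con 1ℚ :- (p :+ p))
           in (K :* (K :* con (ι (+ 1)))) :* (N :* (N :* con (ι (+ 1))))
                :+ con (ι (+ 2)) :* K :* (con (ι (+ 3)) :* (con (ι (+ 2)) :+ M) :- con (ι (+ 5))) :+ con (ι (+ 1))
              := b :* b :+ (w :+ w :+ (w :+ w))) refl Q M)
        (cong D-of (sym P≡1+Q)))
      where
      open +-*-Solver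
      k-1 = natural 2 q ⊖ numeral (+ 1)
      n-3 = natural 2 m ⊖ numeral (+ 3)
      D-of : ℚ → ℚ
      D-of p = let w = p + M * p
                   b = w + (1ℚ - (p + p))
               in b * b + (w + w + (w + w))

    E-formula : ι ((+ suc (suc m) ℤ.- + 1) ℤ.* (+ 3 ℤ.* + suc (suc q) ℤ.- + 5)
                   ℤ.- (+ 2 ℤ.* + suc (suc q) ℤ.- + 3)) ≡ E
    E-formula = trans
      (image ((natural 2 m ⊖ numeral (+ 1)) ⊛ (numeral (+ 3) ⊛ natural 2 q ⊖ numeral (+ 5))
                ⊖ (numeral (+ 2) ⊛ natural 2 q ⊖ numeral (+ 3))))
      (solve 2 (λ Q M →
         (con (ι (+ 2)) :+ M :- con (ι (+ 1))) :* (con (ι (+ 3)) :* (con (ι (+ 2)) :+ Q) :- con (ι (+ 5)))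
           :- (con (ι (+ 2)) :* (con (ι (+ 2)) :+ Q) :- con (ι (+ 3)))
         := Q :+ M :* (con 1ℚ :+ (Q :+ Q) :+ Q)) refl Q M)
      where open +-*-Solver

    -- `fromℤ d` is `fromℚ (ι d)`, so equations in ℚ transport both claims; the integer formulas
    -- enter only through their images `D` and `E`.
    seidelEnergy : ∀ d e → ι d ≡ D → ι e ≡ E →
      Σ[ r ∈ ℝ ] (IsSqrt r (fromℤ d) × IsSeidelEnergy (hyperstar (suc (suc m)) (suc (suc q)) 2≤k) (fromℤ e +ᴿ r))
    seidelEnergy d e ιd≡D ιe≡E =
        √D
      , subst (λ p → IsSqrt √D (fromℚ p)) (sym ιd≡D) √D-isSqrt
      , Vec.lookup eigenvalues , isSpectrum
      , subst (λ p → fromℚ p +ᴿ √D ≃ᴿ ∑ (λ i → ∣ Vec.lookup eigenvalues i ∣ᴿ)) (sym ιe≡E) energy-value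

open import Data.Nat.Base using (ℕ; _≤_)
open import Data.Integer.Base using (+_; _+_; _-_; _*_; _^_)
open import Data.Product.Base using (Σ-syntax; _×_)

theorem4p3 : ∀ (n k : ℕ) → 2 ≤ n → (2≤k : 2 ≤ k) →
    Σ[ r ∈ ℝ ]
    (IsSqrt r (fromℤ ((+ k - + 1) ^ 2 * (+ n - + 3) ^ 2
    + + 2 * (+ k - + 1) * (+ 3 * + n - + 5) + + 1))
    × IsSeidelEnergy (hyperstar n k 2≤k)
    (fromℤ ((+ n - + 1) * (+ 3 * + k - + 5) - (+ 2 * + k - + 3)) +ᴿ r))
theorem4p3 (suc zero)    k             (ℕ.s≤s ())
theorem4p3 (suc (suc m)) (suc zero)    _ (ℕ.s≤s ())
theorem4p3 n@(suc (suc m)) k@(suc (suc q)) _ 2≤k = seidelEnergy m q 2≤k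
  ((+ k - + 1) ^ 2 * (+ n - + 3) ^ 2 + + 2 * (+ k - + 1) * (+ 3 * + n - + 5) + + 1)
  ((+ n - + 1) * (+ 3 * + k - + 5) - (+ 2 * + k - + 3))
  (D-formula m q 2≤k) (E-formula m q 2≤k)
  where open SeidelEnergy.Hyperstar
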